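{- Let $k\ge2$ and $n\ge2$ be integers, let $\mathbf{m}=(k,\dots,k,1)\in\mathbb{Z}^n$, let $d=k(n-2)+1$ be the degree of $A_{\mathbf{m}}^{\mathbf{1}}$, and let $(a,b)$ be the $\mathcal{I}_d$-decomposition of $A_{\mathbf{m}}^{\mathbf{1}}$. Then $$a=\sum_{i=0}^{\lfloor (k(n-2)+1)/2\rfloor}\gamma_{n,i}\,x^i(1+x)^{k(n-2)+1-2i},$$ where $\gamma_{n,i}$ is the number of weakly increasing trees on the multiset $\{1^k,2^k,\dots,(n-2)^k,n-1,n\}$ with $i+1$ leaves and no young leaves.
   Context: For $\mathbf{m}=(m_1,\dots,m_n)$ a vector of positive integers with $m=m_1+\cdots+m_n$, the multiset Eulerian polynomial is $A_{\mathbf{m}}^{\mathbf{1}}=\sum_{\pi}x^{\mathrm{des}(\pi)}$, the sum over all words $\pi=\pi_1\cdots\pi_m$ in which each $j\in\{1,\dots,n\}$ appears exactly $m_j$ times, where $\mathrm{des}(\pi)=|\{j\in\{1,\dots,m-1\}:\pi_j>\pi_{j+1}\}|$. A polynomial $p$ of degree at most $N$ is symmetric with respect to $N$ if $p_s=p_{N-s}$ for $0\le s\le N$. The $\mathcal{I}_N$-decomposition of a polynomial $p$ of degree at most $N$ is the unique pair $(a,b)$ of real polynomials with $p=a+xb$, $\deg a\le N$, $\deg b\le N-1$, $a$ symmetric with respect to $N$ and $b$ symmetric with respect to $N-1$. In a multiset, $j^k$ denotes $k$ copies of $j$. A plane tree is a rooted tree in which the children of each node are (linearly) ordered. A weakly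 increasing tree on a multiset $M$ of positive integers is a plane tree such that (i) it has $|M|+1$ nodes, labeled by the elements of $M\cup\{0\}$ (as a multiset); (ii) the root is labeled $0$ and each node has a label weakly greater than that of its parent; (iii) the labels of the children of each node are weakly increasing from left to right. (Copies of the same label are indistinguishable.) A leaf is a non-root node with no children. A leaf is old if it is the rightmost child of its parent, and young otherwise. -}

module Defs where

open import Algebra.Bundles using (CommutativeRing)
import Algebra.Definitions.RawMonoid as RawMonoidDefs
open import Data.Bool.Base using (if_then_else_)
open import Data.Fin.Base using (Fin)
import Data.Fin.Properties as Fin
open import Data.List.Base using (List; []; _∷_; [_]; _++_; map; concat; foldr; filter; length; replicate; upTo; allFin; cartesianProduct; cartesianProductWith; deduplicate)
open import Data.List.Membership.Propositional using (_∈_)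
open import Data.List.Membership.Propositional.Properties using (∈-map⁺; ∈-map⁻; ∈-filter⁺; ∈-filter⁻; ∈-deduplicate⁺; ∈-cartesianProduct⁺; ∈-∃++; ∈-++⁺ˡ; ∈-++⁺ʳ)
open import Data.List.Membership.DecPropositional using (_∈?_)
open import Data.List.Properties using (length-++)
open import Data.List.Relation.Binary.Permutation.Propositional using (_↭_; ↭-refl; ↭-sym; ↭-trans; prep)
open import Data.List.Relation.Binary.Permutation.Propositional.Properties using (drop-∷; shift; ∈-resp-↭; ↭-length; ¬x∷xs↭[])
open import Data.List.Relation.Unary.All using (All; []; _∷_; all?; lookup; tabulate)
open import Data.List.Relation.Unary.Any using (here; there)
open import Data.List.Relation.Unary.Linked using (Linked; linked?)
open import Data.List.Relation.Unary.Unique.Propositional using (Unique; []; _∷_)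
import Data.List.Relation.Unary.Unique.Propositional.Properties as Unique
import Data.List.Relation.Unary.Unique.DecPropositional.Properties as DecUnique
open import Data.Nat.Base using (ℕ; zero; suc; _+_; _*_; _∸_; _≤_; s≤s)
open import Data.Nat.Properties using (_≟_; _≤?_; ≤-trans; ≤-reflexive; m≤m+n; m≤n+m; suc-injective)
open import Data.Product.Base using (_×_; _,_; proj₁; proj₂)
open import Data.Vec.Base as Vec using (Vec; []; _∷_)
open import Function.Base using (_∘_)
open import Level using (Level)
open import Relation.Binary.PropositionalEquality using (_≡_; refl; sym; trans)
open import Relation.Nullary.Decidable using (Dec; yes; no; does; map′; _×-dec_)
open import Relation.Nullary.Negation using (¬_)
open import Relation.Unary using (Pred; Decidable)

private
  variable
    a : Level
    A : Set a

des : ∀ {n l} → Vec (Fin n) l → ℕ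
des []          = 0
des (x ∷ [])    = 0
des (x ∷ y ∷ w) = (if does (y Fin.<? x) then 1 else 0) + des (y ∷ w)

allWords : ∀ n l → List (Vec (Fin n) l)
allWords n zero    = [ [] ]
allWords n (suc l) = cartesianProductWith _∷_ (allFin n) (allWords n l)

-- The letters 1 < … < n are represented by the elements of Fin n.

HasContent : ∀ {n l} → Vec ℕ n → Vec (Fin n) l → Set
HasContent 𝐦 π = ∀ j → Vec.count (j Fin.≟_) π ≡ Vec.lookup 𝐦 j

hasContent? : ∀ {n l} (𝐦 : Vec ℕ n) → Decidable (HasContent {l = l} 𝐦)
hasContent? 𝐦 π = Fin.all? (λ j → Vec.count (j Fin.≟_) π ≟ Vec.lookup 𝐦 j)

words : ∀ {n} (𝐦 : Vec ℕ n) → List (Vec (Fin n) (Vec.sum 𝐦))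
words {n} 𝐦 = filter (hasContent? 𝐦) (allWords n (Vec.sum 𝐦))

-- Polynomials in one variable, as lists of coefficients (constant term
-- first). Trailing zeros are allowed, so equality is coefficientwise.

module Polynomials {c ℓ} (R : CommutativeRing c ℓ) where

  open CommutativeRing R using (Carrier; _≈_; 0#; 1#; +-rawMonoid)
    renaming (_+_ to _+ᴿ_; _*_ to _*ᴿ_)

  Poly : Set c
  Poly = List Carrier

  coeff : Poly → ℕ → Carrier
  coeff []      _       = 0#
  coeff (r ∷ p) zero    = r
  coeff (r ∷ p) (suc s) = coeff p s

  infix  4 _≋_
  infixl 6 _⊕_
  infixl 7 _⊗_
  infixr 8 _↑_

  _≋_ : Poly → Poly → Set ℓ
  p ≋ q = ∀ s → coeff p s ≈ coeff q s

  _⊕_ : Poly → Poly → Poly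
  []      ⊕ q       = q
  (r ∷ p) ⊕ []      = r ∷ p
  (r ∷ p) ⊕ (t ∷ q) = (r +ᴿ t) ∷ (p ⊕ q)

  _⊗_ : Poly → Poly → Poly
  []      ⊗ q = []
  (r ∷ p) ⊗ q = map (r *ᴿ_) q ⊕ (0# ∷ (p ⊗ q))

  const : ℕ → Poly
  const n = [ RawMonoidDefs._×_ +-rawMonoid n 1# ]

  X : Poly
  X = 0# ∷ 1# ∷ []

  _↑_ : Poly → ℕ → Poly
  p ↑ zero  = const 1
  p ↑ suc e = p ⊗ (p ↑ e)

  ∑ : List A → (A → Poly) → Poly
  ∑ xs f = foldr _⊕_ [] (map f xs)

  DegreeBelow : ℕ → Poly → Set ℓ
  DegreeBelow N p = ∀ s → N ≤ s → coeff p s ≈ 0#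

  SymmetricWrt : ℕ → Poly → Set ℓ
  SymmetricWrt N p = ∀ s → s ≤ N → coeff p s ≈ coeff p (N ∸ s)

  -- For N = 0 the bound deg b ≤ N − 1 forces b = 0, hence DegreeBelow N
  -- rather than a bound in terms of N ∸ 1.

  record IsDecomposition (N : ℕ) (p a b : Poly) : Set ℓ where
    field
      decomposes   : p ≋ a ⊕ X ⊗ b
      a-degree     : DegreeBelow (suc N) a
      b-degree     : DegreeBelow N b
      a-symmetric  : SymmetricWrt N a
      b-symmetric  : SymmetricWrt (N ∸ 1) b

  multisetEulerian : ∀ {n} → Vec ℕ n → Poly
  multisetEulerian 𝐦 = ∑ (words 𝐦) (λ π → X ↑ des π)

data Tree : Set where
  node : (label : ℕ) (children : List Tree) → Tree

label : Tree → ℕ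
label (node j _) = j

labels  : Tree → List ℕ
labelsF : List Tree → List ℕ
labels (node j ts) = j ∷ labelsF ts
labelsF []         = []
labelsF (t ∷ ts)   = labels t ++ labelsF ts

-- The argument of leaves and youngLeaves is not itself counted, being
-- the root; the F-versions count the members of a sequence of siblings.

leaves  : Tree → ℕ
leavesF : List Tree → ℕ
leaves (node _ ts)                = leavesF ts
leavesF []                        = 0
leavesF (node _ []       ∷ ts)    = 1 + leavesF ts
leavesF (node j (u ∷ us) ∷ ts)    = leaves (node j (u ∷ us)) + leavesF ts

youngLeaves  : Tree → ℕ
youngLeavesF : List Tree → ℕ
youngLeaves (node _ ts)                   = youngLeavesF ts
youngLeavesF []                           = 0
youngLeavesF (t ∷ [])                     = youngLeaves t
youngLeavesF (node _ []       ∷ t′ ∷ ts)  = 1 + youngLeavesF (t′ ∷ ts)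
youngLeavesF (node j (u ∷ us) ∷ t′ ∷ ts)  = youngLeaves (node j (u ∷ us)) + youngLeavesF (t′ ∷ ts)

data Increasing : Tree → Set where
  inc : ∀ {j ts} →
        All (λ t → j ≤ label t) ts →
        Linked _≤_ (map label ts) →
        All Increasing ts →
        Increasing (node j ts)

-- The multiset M is given by a list of its elements.

record WeaklyIncreasingTree (M : List ℕ) (t : Tree) : Set where
  constructor wit
  field
    node-labels : labels t ↭ 0 ∷ M
    root-label  : label t ≡ 0
    increasing  : Increasing t

record Enumeration {A : Set a} {p} (P : Pred A p) : Set (a Level.⊔ p) where
  field
    elements : List A
    unique   : Unique elements
    sound    : ∀ {x} → x ∈ elements → P x
    complete : ∀ {x} → P x → x ∈ elements

  cardinality : ℕ
  cardinality = length elements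

open Enumeration using (elements; unique; sound; complete; cardinality)

restrict : ∀ {p q} {P : Pred A p} {Q : Pred A q} → Decidable Q →
           Enumeration P → Enumeration (λ x → P x × Q x)
restrict Q? E .elements         = filter Q? (E .elements)
restrict Q? E .unique           = Unique.filter⁺ Q? (E .unique)
restrict Q? E .sound x∈         = let x∈E , q = ∈-filter⁻ Q? x∈ in E .sound x∈E , q
restrict Q? E .complete (p , q) = ∈-filter⁺ Q? (E .complete p) q

_↭?_ : (xs ys : List ℕ) → Dec (xs ↭ ys)
[]       ↭? []       = yes ↭-refl
[]       ↭? (y ∷ ys) = no (¬x∷xs↭[] ∘ ↭-sym)
(x ∷ xs) ↭? ys with _∈?_ _≟_ x ys
... | no  x∉ys = no (λ p → x∉ys (∈-resp-↭ p (here refl)))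
... | yes x∈ys with ∈-∃++ x∈ys
...   | us , vs , refl = map′
  (λ p → ↭-trans (prep x p) (↭-sym (shift x us vs)))
  (λ p → drop-∷ (↭-trans p (shift x us vs)))
  (xs ↭? (us ++ vs))

increasing?  : Decidable Increasing
increasingF? : Decidable (All Increasing)
increasing? (node j ts) = map′
  (λ (p , q , r) → inc p q r) (λ { (inc p q r) → p , q , r })
  (all? (λ t → j ≤? label t) ts ×-dec linked? _≤?_ (map label ts) ×-dec increasingF? ts)
increasingF? []       = yes []
increasingF? (t ∷ ts) = map′ (λ (p , q) → p ∷ q) (λ { (p ∷ q) → p , q })
  (increasing? t ×-dec increasingF? ts)

weaklyIncreasingTree? : ∀ M → Decidable (WeaklyIncreasingTree M)
weaklyIncreasingTree? M t = map′
  (λ (p , q , r) → wit p q r) (λ (wit p q r) → p , q , r)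
  ((labels t ↭? (0 ∷ M)) ×-dec (label t ≟ 0) ×-dec increasing? t)

private

  graft : ℕ × List Tree × List Tree → List Tree
  graft (j , ts , us) = node j ts ∷ us

  graft-injective : ∀ {x y} → graft x ≡ graft y → x ≡ y
  graft-injective refl = refl

  -- forests s contains every forest of at most s nodes with labels in L,
  -- and some larger ones.

  module _ (L : List ℕ) (L! : Unique L) where

    forests : ℕ → List (List Tree)
    forests zero    = [ [] ]
    forests (suc s) = [] ∷ map graft (cartesianProduct L (cartesianProduct (forests s) (forests s)))

    forests-unique : ∀ s → Unique (forests s)
    forests-unique zero    = [] ∷ []
    forests-unique (suc s) =
      tabulate (λ x∈ []≡x → []≢graft (trans []≡x (proj₂ (proj₂ (∈-map⁻ graft x∈)))))
      ∷ Unique.map⁺ graft-injective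
          (Unique.cartesianProduct⁺ L! (Unique.cartesianProduct⁺ (forests-unique s) (forests-unique s)))
      where
      []≢graft : ∀ {x} → ¬ ([] ≡ graft x)
      []≢graft ()

    forests-complete : ∀ s ts → length (labelsF ts) ≤ s → All (_∈ L) (labelsF ts) → ts ∈ forests s
    forests-complete zero    []               _ _ = here refl
    forests-complete (suc s) []               _ _ = here refl
    forests-complete zero    (node _ _ ∷ _)   () _
    forests-complete (suc s) (node j ts ∷ us) (s≤s l) (j∈L ∷ ∈L) = there (∈-map⁺ graft
      (∈-cartesianProduct⁺ j∈L (∈-cartesianProduct⁺
        (forests-complete s ts (≤-trans (m≤m+n _ _) l′)
          (tabulate (lookup ∈L ∘ ∈-++⁺ˡ)))
        (forests-complete s us (≤-trans (m≤n+m _ _) l′)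
          (tabulate (lookup ∈L ∘ ∈-++⁺ʳ (labelsF ts)))))))
      where
      l′ : length (labelsF ts) + length (labelsF us) ≤ s
      l′ = ≤-trans (≤-reflexive (sym (length-++ (labelsF ts)))) l

  node-injective : ∀ {j ts us} → node j ts ≡ node j us → ts ≡ us
  node-injective refl = refl

weaklyIncreasingTrees : ∀ M → Enumeration (WeaklyIncreasingTree M)
weaklyIncreasingTrees M = record
  { elements = filter (weaklyIncreasingTree? M) candidates
  ; unique   = Unique.filter⁺ (weaklyIncreasingTree? M)
                 (Unique.map⁺ node-injective (forests-unique L L! (length M)))
  ; sound    = proj₂ ∘ ∈-filter⁻ (weaklyIncreasingTree? M) {xs = candidates}
  ; complete = λ w → ∈-filter⁺ (weaklyIncreasingTree? M) (candidate w) w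
  }
  where
  L : List ℕ
  L = deduplicate _≟_ (0 ∷ M)

  L! : Unique L
  L! = DecUnique.deduplicate-! _≟_ (0 ∷ M)

  candidates : List Tree
  candidates = map (node 0) (forests L L! (length M))

  candidate : ∀ {t} → WeaklyIncreasingTree M t → t ∈ candidates
  candidate {node .0 ts} (wit p refl _) = ∈-map⁺ (node 0)
    (forests-complete L L! (length M) ts
      (≤-reflexive (suc-injective (↭-length p)))
      (tabulate (λ j∈ → ∈-deduplicate⁺ _≟_ (∈-resp-↭ p (there j∈)))))

-- {1ᵏ, 2ᵏ, …, (n−2)ᵏ, n−1, n}, for n ≥ 2

treeMultiset : (k n : ℕ) → List ℕ
treeMultiset k n = concat (map (λ j → replicate k (suc j)) (upTo (n ∸ 2))) ++ (n ∸ 1) ∷ n ∷ []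

γ-trees : ∀ k n i → Enumeration (λ t →
  WeaklyIncreasingTree (treeMultiset k n) t × (leaves t ≡ i + 1 × youngLeaves t ≡ 0))
γ-trees k n i = restrict (λ t → (leaves t ≟ i + 1) ×-dec (youngLeaves t ≟ 0))
  (weaklyIncreasingTrees (treeMultiset k n))

γ : (k n i : ℕ) → ℕ
γ k n i = cardinality (γ-trees k n i)

module Submission where

-- Reading a forest as a binary tree (first child on the left, next sibling on the right), a leaf is a
-- node without left child and a young leaf a node with a right child only. Turning single children
-- from left to right expands the polynomial counting all weakly increasing trees by leaves in the
-- basis xⁱ(1 + x)ᵈ⁻²ⁱ with coefficients γᵢ, so it remains to see that this polynomial is a.
--
-- Let B be the descent polynomial of the words on {1ᵏ, …, (n−1)ᵏ}. Inserting k copies of a new largest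
-- letter into a word, and adding k equal nodes to a tree (counted by Lagrange inversion), have
-- compatible effects, and by induction B also counts the trees on {1ᵏ, …, (n−2)ᵏ, n−1} by leaves,
-- shifted by one. Inserting n once on both sides then gives A = a + (k − 1) x B, where a counts the
-- trees on {1ᵏ, …, (n−2)ᵏ, n−1, n}. Reflecting binary trees shows that a and B are palindromic, so
-- this is the decomposition, which is unique.

open import Defs
open import Algebra.Bundles using (CommutativeRing)
import Algebra.Definitions.RawMonoid as RawMonoidDefs
import Algebra.Properties.CommutativeSemigroup as CommutativeSemigroupProperties
import Algebra.Properties.Ring as RingProperties
import Algebra.Properties.Semiring.Mult as Mult
open import Data.Bool.Base using (if_then_else_; true; false)
open import Data.Fin.Base as Fin using (Fin; toℕ; fromℕ<)
open import Data.Fin.Properties as Fin using (toℕ-injective; toℕ<n; toℕ-fromℕ<)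
open import Data.List.Base as List using (List; []; _∷_; _++_; [_]; map; concat; concatMap; cartesianProductWith; upTo; filter; length)
open import Data.List.Membership.Propositional using (_∈_; _∉_; find; lose)
open import Data.List.Membership.Propositional.Properties using (∈-∃++; ∈-++⁻; ∈-++⁺ˡ; ∈-++⁺ʳ; ∈-map⁻; ∈-map⁺; ∈-filter⁻; ∈-filter⁺; ∈-allFin; ∈-concatMap⁻; ∈-concatMap⁺; ∈-cartesianProductWith⁻; ∈-cartesianProductWith⁺)
open import Data.List.Membership.Propositional.Properties.WithK using (unique∧set⇒bag)
open import Data.List.Properties using (map-++; map-∘; map-cong; length-++; length-map; length-replicate; concat-++; upTo-∷ʳ; ++-assoc; ++-identityʳ; ∷-injectiveˡ; ∷-injectiveʳ; filter-all; filter-accept; filter-reject)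
open import Data.List.Relation.Binary.BagAndSetEquality using (∼bag⇒↭)
open import Data.List.Relation.Binary.Permutation.Propositional using (_↭_; ↭-refl; ↭-sym; ↭-trans; prep)
open import Data.List.Relation.Binary.Permutation.Propositional.Properties using (map⁺; shift; drop-∷; ↭-length; All-resp-↭)
open import Data.List.Relation.Unary.All as All using (All; []; _∷_)
open import Data.List.Relation.Unary.All.Properties using (++⁻; map⁻; filter⁺; all-filter)
open import Data.List.Relation.Unary.Any using (here; there)
open import Data.List.Relation.Unary.Linked using (Linked; []; [-]; _∷_)
open import Data.List.Relation.Unary.Linked.Properties using (Linked⇒All)
open import Data.List.Relation.Unary.Unique.Propositional using (Unique; []; _∷_)
import Data.List.Relation.Unary.Unique.Propositional.Properties as Unique
open import Data.Nat.Base
open import Data.Nat.ListAction using (sum)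
open import Data.Nat.ListAction.Properties using (sum-++; sum-↭)
open import Data.Nat.Properties
open import Data.Nat.Tactic.RingSolver using (solve-∀)
open import Data.Product.Base using (_×_; _,_; proj₁; proj₂; map₁; ∃₂; ∃-syntax)
open import Data.Sum.Base using (inj₁; inj₂)
open import Data.Vec.Base as Vec using (Vec; []; _∷_; replicate; _∷ʳ_)
open import Function.Base using (_∘_; flip)
open import Function.Bundles using (mk⇔)
open import Level using (Level)
open import Relation.Binary.Definitions using (tri<; tri≈; tri>)
open import Relation.Binary.PropositionalEquality hiding ([_])
open import Relation.Nullary.Decidable using (yes; no; does; dec-true; dec-false; ¬?)
open import Relation.Nullary.Negation using (contradiction)
open import Relation.Unary using (Pred)

open Enumeration using (elements; unique; sound; complete; cardinality)
open CommutativeSemigroupProperties +-commutativeSemigroup using (interchange; x∙yz≈y∙xz; x∙yz≈y∙zx; xy∙z≈zx∙y)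

private
  variable
    a b p q : Level
    A B : Set a
    n l : ℕ

-- The words of the next stage arise from the present words by inserting k letters, but the trees of
-- the next stage do not arise from the present trees: the lone top node of {1ᵏ, ..., Nᵏ, N + 1}
-- gives way to k copies of N + 1 and a new lone node N + 2. Both stages are therefore compared over
-- a common forest on {1ᵏ, ..., Nᵏ}, of which only the numbers ℓ and r of free left and right slots
-- matter. Over it, adding k nodes and then one must agree with adding one node and then applying
-- the insertion count of words. `place-swap` proves this as an identity between products of
-- binomial coefficients, not by a bijection.
--
-- The constant k - 1 is an excess of rises over slots: a word with e descents is matched with trees
-- having e + 1 leaves, and its weak rises, the start included, outnumber the right slots of such a
-- tree by k - 1.
--
-- All counting stays in ℕ: polynomials are replaced by sums of test functions, mostly `δ q`, over
-- lists, and differences by equations with terms moved to the other side.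

-- Kronecker delta and binomial coefficients

δ : ℕ → ℕ → ℕ
δ zero    zero    = 1
δ zero    (suc _) = 0
δ (suc _) zero    = 0
δ (suc m) (suc n) = δ m n

δ-refl : ∀ n → δ n n ≡ 1
δ-refl zero    = refl
δ-refl (suc n) = δ-refl n

δ-≢ : ∀ {m n} → m ≢ n → δ m n ≡ 0
δ-≢ {zero}  {zero}  m≢n = contradiction refl m≢n
δ-≢ {zero}  {suc n} m≢n = refl
δ-≢ {suc m} {zero}  m≢n = refl
δ-≢ {suc m} {suc n} m≢n = δ-≢ (m≢n ∘ cong suc)

δ-sift : ∀ m n (h : ℕ → ℕ) → h m * δ m n ≡ h n * δ m n
δ-sift m n h with m ≟ n
... | yes refl = refl
... | no  m≢n  rewrite δ-≢ m≢n = trans (*-zeroʳ (h m)) (sym (*-zeroʳ (h n)))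

-- binom c ℓ h is the value on x ^ ℓ * (1 + x) ^ c of the linear functional x ^ i ↦ h i.

binom : ℕ → ℕ → (ℕ → ℕ) → ℕ
binom zero    ℓ h = h ℓ
binom (suc c) ℓ h = binom c ℓ h + binom c (suc ℓ) h

binom-shift : ∀ c ℓ h → binom c (suc ℓ) h ≡ binom c ℓ (h ∘ suc)
binom-shift zero    ℓ h = refl
binom-shift (suc c) ℓ h = cong₂ _+_ (binom-shift c ℓ h) (binom-shift c (suc ℓ) h)

binom-* : ∀ c c′ ℓ ℓ′ h →
          binom c ℓ (λ i → binom c′ ℓ′ (λ j → h (i + j))) ≡ binom (c + c′) (ℓ + ℓ′) h
binom-* zero    c′ zero    ℓ′ h = refl
binom-* zero    c′ (suc ℓ) ℓ′ h = trans (binom-* zero c′ ℓ ℓ′ (h ∘ suc)) (sym (binom-shift c′ (ℓ + ℓ′) h))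
binom-* (suc c) c′ ℓ       ℓ′ h = cong₂ _+_ (binom-* c c′ ℓ ℓ′ h) (binom-* c c′ (suc ℓ) ℓ′ h)

-- The coefficient of x ^ q in x ^ ℓ * (1 + x) ^ c, that is, c choose q − ℓ.

choose : ℕ → ℕ → ℕ → ℕ
choose c q ℓ = binom c ℓ (δ q)

choose-shift : ∀ c q ℓ → choose c (suc q) (suc ℓ) ≡ choose c q ℓ
choose-shift c q ℓ = binom-shift c ℓ (δ (suc q))

choose-low : ∀ c {q ℓ} → q < ℓ → choose c q ℓ ≡ 0
choose-low zero    q<ℓ = δ-≢ (<⇒≢ q<ℓ)
choose-low (suc c) q<ℓ = cong₂ _+_ (choose-low c q<ℓ) (choose-low c (m<n⇒m<1+n q<ℓ))

choose-high : ∀ c {q ℓ} → ℓ + c < q → choose c q ℓ ≡ 0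
choose-high zero    {q} {ℓ} lt = δ-≢ (>⇒≢ (subst (_< q) (+-identityʳ ℓ) lt))
choose-high (suc c) {q} {ℓ} lt = cong₂ _+_ (choose-high c (<-trans (n<1+n (ℓ + c)) lt′)) (choose-high c lt′)
  where
  lt′ : suc (ℓ + c) < q
  lt′ = subst (_< q) (+-suc ℓ c) lt

choose-bottom : ∀ c ℓ → choose c ℓ ℓ ≡ 1
choose-bottom zero    ℓ = δ-refl ℓ
choose-bottom (suc c) ℓ rewrite choose-bottom c ℓ | choose-low c (n<1+n ℓ) = refl

choose-top : ∀ c ℓ → choose c (ℓ + c) ℓ ≡ 1
choose-top zero    ℓ rewrite +-identityʳ ℓ = δ-refl ℓ
choose-top (suc c) ℓ rewrite +-suc ℓ c | choose-high c (n<1+n (ℓ + c)) = choose-top c (suc ℓ)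

-- Coefficient of x^q in x times the derivative of x^ℓ (1 + x)^(c + 1): by the product rule this is
-- x^ℓ (1 + x)^c times ℓ (1 + x) + (c + 1) x. It serves to remove the factor `q` in `place-swap`.
absorption : ∀ c q ℓ →
  q * choose c q ℓ + q * choose c q (suc ℓ) ≡ ℓ * choose c q ℓ + (c + ℓ + 1) * choose c q (suc ℓ)
absorption zero    q ℓ = cong₂ _+_ (sift q ℓ) (trans (sift q (suc ℓ)) (cong (_* δ q (suc ℓ)) (+-comm 1 ℓ)))
  where
  sift : ∀ m n → m * δ m n ≡ n * δ m n
  sift m n = δ-sift m n (λ i → i)
absorption (suc c) q ℓ =
  merge q c ℓ (choose c q ℓ) (choose c q (suc ℓ)) (choose c q (suc (suc ℓ)))
    (absorption c q ℓ) (absorption c q (suc ℓ))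
  where
  merge : ∀ q c ℓ x y z →
    q * x + q * y ≡ ℓ * x + (c + ℓ + 1) * y →
    q * y + q * z ≡ suc ℓ * y + (c + suc ℓ + 1) * z →
    q * (x + y) + q * (y + z) ≡ ℓ * (x + y) + (suc c + ℓ + 1) * (y + z)
  merge q c ℓ x y z e₁ e₂ = trans (left q x y z) (trans (cong₂ _+_ e₁ e₂) (right c ℓ x y z))
    where
    left : ∀ q x y z → q * (x + y) + q * (y + z) ≡ (q * x + q * y) + (q * y + q * z)
    left = solve-∀
    right : ∀ c ℓ x y z → (ℓ * x + (c + ℓ + 1) * y) + (suc ℓ * y + (c + suc ℓ + 1) * z)
                        ≡ ℓ * (x + y) + (suc c + ℓ + 1) * (y + z)
    right = solve-∀

-- Placements of equal nodes in a binary tree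

-- place k ℓ r h sums h over the ways to add k further nodes to a binary tree with ℓ free left and
-- r free right slots; a new node brings one free slot of each kind, and h is applied to the final
-- numbers of free slots. The slots are decided one after the other, left ones first.

place : ℕ → ℕ → ℕ → (ℕ → ℕ → ℕ) → ℕ
place zero    ℓ       r       h = h ℓ r
place (suc k) zero    zero    h = 0
place (suc k) zero    (suc r) h = place (suc k) zero r (λ x y → h x (suc y)) + place k 1 (suc r) h
place (suc k) (suc ℓ) r       h = place (suc k) ℓ r (λ x y → h (suc x) y) + place k (suc ℓ) (suc r) h

-- Each added node takes one slot and brings two, so every placement ends with `k + (ℓ + r)` free
-- slots, and `h` is evaluated only there.
place-cong : ∀ k ℓ r {h h′ : ℕ → ℕ → ℕ} →
             (∀ x y → x + y ≡ k + (ℓ + r) → h x y ≡ h′ x y) → place k ℓ r h ≡ place k ℓ r h′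
place-cong zero    ℓ       r       eq = eq ℓ r refl
place-cong (suc k) zero    zero    eq = refl
place-cong (suc k) zero    (suc r) eq = cong₂ _+_
  (place-cong (suc k) zero r (λ x y p → eq x (suc y) (trans (+-suc x y) (trans (cong suc p) (cong suc (sym (+-suc k r)))))))
  (place-cong k 1 (suc r) (λ x y p → eq x y (trans p (+-suc k (suc r)))))
place-cong (suc k) (suc ℓ) r       eq = cong₂ _+_
  (place-cong (suc k) ℓ r (λ x y p → eq (suc x) y (cong suc (trans p (sym (+-suc k (ℓ + r)))))))
  (place-cong k (suc ℓ) (suc r) (λ x y p → eq x y (trans p (trans (cong (k +_) (+-suc (suc ℓ) r)) (+-suc k (suc ℓ + r))))))

place-+ : ∀ k ℓ r h h′ → place k ℓ r (λ x y → h x y + h′ x y) ≡ place k ℓ r h + place k ℓ r h′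
place-+ zero    ℓ       r       h h′ = refl
place-+ (suc k) zero    zero    h h′ = refl
place-+ (suc k) zero    (suc r) h h′
  rewrite place-+ (suc k) zero r (λ x y → h x (suc y)) (λ x y → h′ x (suc y)) | place-+ k 1 (suc r) h h′ =
  interchange (place (suc k) 0 r (λ x y → h x (suc y))) _ _ _
place-+ (suc k) (suc ℓ) r       h h′
  rewrite place-+ (suc k) ℓ r (λ x y → h (suc x) y) (λ x y → h′ (suc x) y) | place-+ k (suc ℓ) (suc r) h h′ =
  interchange (place (suc k) ℓ r (λ x y → h (suc x) y)) _ _ _

place-* : ∀ k ℓ r m h → place k ℓ r (λ x y → m * h x y) ≡ m * place k ℓ r h
place-* zero    ℓ       r       m h = refl
place-* (suc k) zero    zero    m h = sym (*-zeroʳ m)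
place-* (suc k) zero    (suc r) m h
  rewrite place-* (suc k) zero r m (λ x y → h x (suc y)) | place-* k 1 (suc r) m h =
  sym (*-distribˡ-+ m (place (suc k) 0 r (λ x y → h x (suc y))) _)
place-* (suc k) (suc ℓ) r       m h
  rewrite place-* (suc k) ℓ r m (λ x y → h (suc x) y) | place-* k (suc ℓ) (suc r) m h =
  sym (*-distribˡ-+ m (place (suc k) ℓ r (λ x y → h (suc x) y)) _)

-- The order in which slots are decided does not matter: although `place` treats left slots before
-- right ones, a right slot may be decided at any time. Reflection and convolution both depend on
-- this.
place-right : ∀ k ℓ r h →
  place (suc k) ℓ (suc r) h ≡ place (suc k) ℓ r (λ x y → h x (suc y)) + place k (suc ℓ) (suc r) h

-- The generating functions y and z of a free left and a free right slot satisfy y + 1 = z + x.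

place-exchange : ∀ k ℓ r h →
    place k (suc ℓ) (suc r) (λ x y → h (suc x) y) + place k (suc ℓ) (suc (suc r)) h
  ≡ place k (suc ℓ) (suc r) (λ x y → h x (suc y)) + place k (suc (suc ℓ)) (suc r) h

place-right k zero    r h = refl
place-right k (suc ℓ) r h
  rewrite place-right k ℓ r (λ x y → h (suc x) y) = begin
  (s + place k (suc ℓ) (suc r) (λ x y → h (suc x) y)) + place k (suc ℓ) (suc (suc r)) h  ≡⟨ +-assoc s _ _ ⟩
  s + (place k (suc ℓ) (suc r) (λ x y → h (suc x) y) + place k (suc ℓ) (suc (suc r)) h)  ≡⟨ cong (s +_) (place-exchange k ℓ r h) ⟩
  s + (place k (suc ℓ) (suc r) (λ x y → h x (suc y)) + place k (suc (suc ℓ)) (suc r) h)  ≡⟨ +-assoc s _ _ ⟨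
  (s + place k (suc ℓ) (suc r) (λ x y → h x (suc y))) + place k (suc (suc ℓ)) (suc r) h  ∎
  where
  open ≡-Reasoning
  s = place (suc k) ℓ r (λ x y → h (suc x) (suc y))

place-exchange zero    ℓ r h = +-comm (h (suc (suc ℓ)) (suc r)) _
place-exchange (suc k) ℓ r h rewrite place-right k (suc ℓ) (suc r) h =
  x∙yz≈y∙xz (place (suc k) (suc ℓ) (suc r) (λ x y → h (suc x) y)) (place (suc k) (suc ℓ) (suc r) (λ x y → h x (suc y))) _

place-mirror : ∀ k ℓ r h → place k ℓ r h ≡ place k r ℓ (flip h)
place-mirror zero    ℓ       r       h = refl
place-mirror (suc k) zero    zero    h = refl
place-mirror (suc k) zero    (suc r) h =
  cong₂ _+_ (place-mirror (suc k) zero r (λ x y → h x (suc y))) (place-mirror k 1 (suc r) h)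
place-mirror (suc k) (suc ℓ) r       h = trans
  (cong₂ _+_ (place-mirror (suc k) ℓ r (λ x y → h (suc x) y)) (place-mirror k (suc ℓ) (suc r) h))
  (sym (place-right k r ℓ (flip h)))

place-one : ∀ ℓ r h → place 1 ℓ r h ≡ ℓ * h ℓ (suc r) + r * h (suc ℓ) r
place-one zero    zero    h = refl
place-one zero    (suc r) h rewrite place-one zero r (λ x y → h x (suc y)) = +-comm (r * h 1 (suc r)) _
place-one (suc ℓ) r       h rewrite place-one ℓ r (λ x y → h (suc x) y) =
  xy∙z≈zx∙y (ℓ * h (suc ℓ) (suc r)) (r * h (suc (suc ℓ)) r) _

-- The number of placements leaving q − e free left slots is the difference of
-- choose a q (e + 1) * choose b q (e + ℓ) and choose a q e * choose b q (e + ℓ + 1), by Lagrange inversion.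

place-δ : ∀ k ℓ r e q →
    place (suc k) ℓ r (λ x _ → δ q (e + x)) + choose (ℓ + k) q e * choose (r + k) q (suc (e + ℓ))
  ≡ choose (ℓ + k) q (suc e) * choose (r + k) q (e + ℓ)
-- The same formula for one node fewer and at least one slot of each kind, the situation after a
-- node has been placed. In this form the number of nodes may be zero.
place-δ₀ : ∀ k ℓ r e q →
    place k (suc ℓ) (suc r) (λ x _ → δ q (e + x)) + choose (ℓ + k) q e * choose (r + k) q (suc (suc (e + ℓ)))
  ≡ choose (ℓ + k) q (suc e) * choose (r + k) q (suc (e + ℓ))

place-δ k zero    zero    e q rewrite +-identityʳ e = *-comm (choose k q e) _
place-δ k zero    (suc r) e q
  with ih₁ ← place-δ k zero r e q | ih₂ ← place-δ₀ k zero r e q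
  rewrite +-identityʳ e =
  combine (place (suc k) 0 r (λ x _ → δ q (e + x))) (place k 1 (suc r) (λ x _ → δ q (e + x)))
    (choose k q e) (choose k q (suc e)) (choose (r + k) q e) (choose (r + k) q (suc e)) (choose (r + k) q (suc (suc e))) ih₁ ih₂
  where
  combine : ∀ p p′ x y u v w → p + x * v ≡ y * u → p′ + x * w ≡ y * v →
            (p + p′) + x * (v + w) ≡ y * (u + v)
  combine p p′ x y u v w e₁ e₂ = trans (left p p′ x v w) (trans (cong₂ _+_ e₁ e₂) (sym (*-distribˡ-+ y u v)))
    where
    left : ∀ p p′ x v w → (p + p′) + x * (v + w) ≡ (p + x * v) + (p′ + x * w)
    left = solve-∀
place-δ k (suc ℓ) r e q
  -- A left slot that stays free is recorded in the offset, hence `suc e`; a slot that is filled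
  -- leads to `place-δ₀`.
  with ih₁ ← place-δ k ℓ r (suc e) q | ih₂ ← place-δ₀ k ℓ r e q
  rewrite +-suc e ℓ
        | place-cong (suc k) ℓ r {λ x y → δ q (e + suc x)} {λ x y → δ q (suc (e + x))} (λ x y _ → cong (δ q) (+-suc e x)) =
  combine (place (suc k) ℓ r (λ x _ → δ q (suc (e + x)))) (place k (suc ℓ) (suc r) (λ x _ → δ q (e + x)))
    (choose (ℓ + k) q e) (choose (ℓ + k) q (suc e)) (choose (ℓ + k) q (suc (suc e))) (choose (r + k) q (suc (e + ℓ))) _ ih₁ ih₂
  where
  combine : ∀ p p′ x y z u v → p + y * v ≡ z * u → p′ + x * v ≡ y * u →
            (p + p′) + (x + y) * v ≡ (y + z) * u
  combine p p′ x y z u v e₁ e₂ = trans (left p p′ x y v) (trans (cong₂ _+_ e₁ e₂) (right y z u))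
    where
    left : ∀ p p′ x y v → (p + p′) + (x + y) * v ≡ (p + y * v) + (p′ + x * v)
    left = solve-∀
    right : ∀ y z u → z * u + y * u ≡ (y + z) * u
    right = solve-∀

-- As functions of `q`, the factors on the right are supported on [e + 1, e + 1 + ℓ] and from e + 1
-- + ℓ on, so they meet in a single point, which the delta accounts for; the two factors on the left
-- never meet.
place-δ₀ zero    ℓ r e q rewrite +-suc e ℓ | +-identityʳ ℓ | +-identityʳ r with <-cmp q (suc (e + ℓ))
... | tri< q< _ _
  rewrite δ-≢ (<⇒≢ q<) | choose-low r q< | choose-low r (m<n⇒m<1+n q<)
        | *-zeroʳ (choose ℓ q e) | *-zeroʳ (choose ℓ q (suc e)) = refl
... | tri≈ _ refl _
  rewrite δ-refl (e + ℓ) | choose-low r (n<1+n (suc (e + ℓ))) | *-zeroʳ (choose ℓ (suc (e + ℓ)) e)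
        | choose-bottom r (suc (e + ℓ)) | choose-top ℓ (suc e) = refl
... | tri> _ _ q>
  rewrite δ-≢ (>⇒≢ q>) | choose-high ℓ {q} {suc e} q> | choose-high ℓ {q} {e} (<-trans (n<1+n (e + ℓ)) q>) = refl
place-δ₀ (suc k) ℓ r e q
  with ih ← place-δ k (suc ℓ) (suc r) e q
  rewrite +-suc ℓ k | +-suc r k | +-suc e ℓ = ih

-- Linear combination without subtraction: `u` and `v` collect the two sides of the equations being
-- combined.
cancel : ∀ {x y u v : ℕ} → x + u ≡ y + v → u ≡ v → x ≡ y
cancel {x} {y} {u} eq refl = +-cancelʳ-≡ u x y eq

-- The induction step over a fixed forest with `ℓ` and `r` slots. The product on the right counts
-- the insertions of `suc k` letters into a word with `x − 1` descents, the partner of a tree with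
-- `x` leaves. The left side is linear in two values of `place-δ` once the last node has been
-- placed, so the claim becomes an identity of binomial coefficients.
place-swap : ∀ k ℓ r q →
    place (suc k) ℓ r (λ x y → place 1 x y (λ x′ _ → δ q x′))
  ≡ place 1 ℓ r (λ x y → choose (x + k) q 1 * choose (y + k) q x)
place-swap k ℓ r q = begin
  place (suc k) ℓ r (λ x y → place 1 x y (λ x′ _ → δ q x′))
    ≡⟨ combine (place (suc k) ℓ r (λ x y → place 1 x y (λ x′ _ → δ q x′))) p₁ p₀ q ℓ r k
         (choose (ℓ + k) q 0) (choose (ℓ + k) q 1) (choose (ℓ + k) q 2)
         (choose (r + k) q ℓ) (choose (r + k) q (suc ℓ)) (choose (r + k) q (suc (suc ℓ)))
         counted (place-δ k ℓ r 0 q) (place-δ k ℓ r 1 q)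
         (absorption (r + k) q ℓ) (absorption (ℓ + k) q 0) (absorption (ℓ + k) q 1) (absorption (r + k) q (suc ℓ)) ⟩
  ℓ * (choose (ℓ + k) q 1 * choose (suc r + k) q ℓ) + r * (choose (suc ℓ + k) q 1 * choose (r + k) q (suc ℓ))
    ≡⟨ place-one ℓ r _ ⟨
  place 1 ℓ r (λ x y → choose (x + k) q 1 * choose (y + k) q x)
    ∎
  where
  open ≡-Reasoning
  S = suc k + (ℓ + r)
  p₁ = place (suc k) ℓ r (λ x _ → δ q x)
  p₀ = place (suc k) ℓ r (λ x _ → δ q (suc x))

  -- Where a delta is nonzero, `q` determines `x`, and `S` then determines `y`, so the weights `x`
  -- and `y` become constants. The coefficient of `δ q (suc x)` is `suc S − q`; its negative part
  -- stands on the left.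
  pointwise : ∀ x y → x + y ≡ S →
              place 1 x y (λ x′ _ → δ q x′) + q * δ q (suc x) ≡ q * δ q x + suc S * δ q (suc x)
  pointwise x y eq = begin
    place 1 x y (λ x′ _ → δ q x′) + q * δ q (suc x)          ≡⟨ cong (_+ q * δ q (suc x)) (place-one x y (λ x′ _ → δ q x′)) ⟩
    x * δ q x + y * δ q (suc x) + q * δ q (suc x)            ≡⟨ cong₂ (λ u v → u + y * δ q (suc x) + v) (δ-sift q x (λ i → i)) (sym (δ-sift q (suc x) (λ i → i))) ⟨
    q * δ q x + y * δ q (suc x) + suc x * δ q (suc x)        ≡⟨ regroup (q * δ q x) x y (δ q (suc x)) ⟩
    q * δ q x + suc (x + y) * δ q (suc x)                    ≡⟨ cong (λ n → q * δ q x + suc n * δ q (suc x)) eq ⟩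
    q * δ q x + suc S * δ q (suc x)                          ∎
    where
    regroup : ∀ u x y v → u + y * v + suc x * v ≡ u + suc (x + y) * v
    regroup = solve-∀

  counted : place (suc k) ℓ r (λ x y → place 1 x y (λ x′ _ → δ q x′)) + q * p₀ ≡ q * p₁ + suc S * p₀
  counted = begin
    place (suc k) ℓ r (λ x y → place 1 x y (λ x′ _ → δ q x′)) + q * p₀
      ≡⟨ cong (place (suc k) ℓ r (λ x y → place 1 x y (λ x′ _ → δ q x′)) +_) (place-* (suc k) ℓ r q (λ x _ → δ q (suc x))) ⟨
    place (suc k) ℓ r (λ x y → place 1 x y (λ x′ _ → δ q x′)) + place (suc k) ℓ r (λ x _ → q * δ q (suc x))
      ≡⟨ place-+ (suc k) ℓ r _ (λ x _ → q * δ q (suc x)) ⟨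
    place (suc k) ℓ r (λ x y → place 1 x y (λ x′ _ → δ q x′) + q * δ q (suc x))
      ≡⟨ place-cong (suc k) ℓ r pointwise ⟩
    place (suc k) ℓ r (λ x _ → q * δ q x + suc S * δ q (suc x))
      ≡⟨ place-+ (suc k) ℓ r (λ x _ → q * δ q x) _ ⟩
    place (suc k) ℓ r (λ x _ → q * δ q x) + place (suc k) ℓ r (λ x _ → suc S * δ q (suc x))
      ≡⟨ cong₂ _+_ (place-* (suc k) ℓ r q (λ x _ → δ q x)) (place-* (suc k) ℓ r (suc S) (λ x _ → δ q (suc x))) ⟩
    q * p₁ + suc S * p₀
      ∎

  combine : ∀ p p₁ p₀ q ℓ r k α₂ α₁ α₀ β₂ β₁ β₀ →
    p + q * p₀ ≡ q * p₁ + suc (suc k + (ℓ + r)) * p₀ →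
    p₁ + α₂ * β₁ ≡ α₁ * β₂ →
    p₀ + α₁ * β₀ ≡ α₀ * β₁ →
    q * β₂ + q * β₁ ≡ ℓ * β₂ + (r + k + ℓ + 1) * β₁ →
    q * α₂ + q * α₁ ≡ 0 * α₂ + (ℓ + k + 0 + 1) * α₁ →
    q * α₁ + q * α₀ ≡ 1 * α₁ + (ℓ + k + 1 + 1) * α₀ →
    q * β₁ + q * β₀ ≡ suc ℓ * β₁ + (r + k + suc ℓ + 1) * β₀ →
    p ≡ ℓ * (α₁ * (β₂ + β₁)) + r * ((α₁ + α₀) * β₁)
  combine p p₁ p₀ q ℓ r k α₂ α₁ α₀ β₂ β₁ β₀ e e₁ e₀ b₀ a₀ a₁ b₁ =
    -- Formally p = q p₁ + (suc S - q) p₀, so `e₀` is used twice, in opposite directions, with the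
    -- multipliers `suc S` and `q`. The remaining products with `q` share a factor `α₁` or `β₁`, by
    -- which the absorption identities are multiplied.
    cancel
      (identity p p₁ p₀ q ℓ r k α₂ α₁ α₀ β₂ β₁ β₀)
      (cong₂ _+_ (cong₂ _+_ (cong₂ _+_ (cong₂ _+_ (cong₂ _+_ (cong₂ _+_ (cong₂ _+_ (sym e)
        (cong (q *_) (sym e₁)))
        (cong (suc (suc k + (ℓ + r)) *_) (sym e₀)))
        (cong (q *_) e₀))
        (cong (α₁ *_) (sym b₀)))
        (cong (β₁ *_) a₀))
        (cong (β₁ *_) a₁))
        (cong (α₁ *_) (sym b₁)))
    where
    identity : ∀ p p₁ p₀ q ℓ r k α₂ α₁ α₀ β₂ β₁ β₀ →
      p + (q * p₁ + suc (suc k + (ℓ + r)) * p₀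
         + q * (α₁ * β₂)
         + suc (suc k + (ℓ + r)) * (α₀ * β₁)
         + q * (p₀ + α₁ * β₀)
         + α₁ * (ℓ * β₂ + (r + k + ℓ + 1) * β₁)
         + β₁ * (q * α₂ + q * α₁)
         + β₁ * (q * α₁ + q * α₀)
         + α₁ * (suc ℓ * β₁ + (r + k + suc ℓ + 1) * β₀))
      ≡ ℓ * (α₁ * (β₂ + β₁)) + r * ((α₁ + α₀) * β₁)
        + (p + q * p₀
         + q * (p₁ + α₂ * β₁)
         + suc (suc k + (ℓ + r)) * (p₀ + α₁ * β₀)
         + q * (α₀ * β₁)
         + α₁ * (q * β₂ + q * β₁)
         + β₁ * (0 * α₂ + (ℓ + k + 0 + 1) * α₁)
         + β₁ * (1 * α₁ + (ℓ + k + 1 + 1) * α₀)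
         + α₁ * (q * β₁ + q * β₀))
    identity = solve-∀

-- Finite sums over lists

∑ℕ : List A → (A → ℕ) → ℕ
∑ℕ xs h = sum (map h xs)

∑ℕ-++ : ∀ (xs ys : List A) h → ∑ℕ (xs ++ ys) h ≡ ∑ℕ xs h + ∑ℕ ys h
∑ℕ-++ xs ys h = trans (cong sum (map-++ h xs ys)) (sum-++ (map h xs) (map h ys))

∑ℕ-map : ∀ (f : A → B) xs h → ∑ℕ (map f xs) h ≡ ∑ℕ xs (h ∘ f)
∑ℕ-map f xs h = cong sum (sym (map-∘ xs))

∑ℕ-cong : ∀ (xs : List A) {h h′ : A → ℕ} → (∀ x → h x ≡ h′ x) → ∑ℕ xs h ≡ ∑ℕ xs h′
∑ℕ-cong xs eq = cong sum (map-cong eq xs)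

∑ℕ-cong-∈ : ∀ (xs : List A) {h h′ : A → ℕ} → (∀ {x} → x ∈ xs → h x ≡ h′ x) → ∑ℕ xs h ≡ ∑ℕ xs h′
∑ℕ-cong-∈ []       eq = refl
∑ℕ-cong-∈ (x ∷ xs) eq = cong₂ _+_ (eq (here refl)) (∑ℕ-cong-∈ xs (eq ∘ there))

∑ℕ-↭ : ∀ {xs ys : List A} (h : A → ℕ) → xs ↭ ys → ∑ℕ xs h ≡ ∑ℕ ys h
∑ℕ-↭ h p = sum-↭ (map⁺ h p)

∑ℕ-concatMap : ∀ (f : A → List B) xs h → ∑ℕ (concatMap f xs) h ≡ ∑ℕ xs (λ x → ∑ℕ (f x) h)
∑ℕ-concatMap f []       h = refl
∑ℕ-concatMap f (x ∷ xs) h = trans (∑ℕ-++ (f x) _ h) (cong (∑ℕ (f x) h +_) (∑ℕ-concatMap f xs h))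

∑ℕ-cartesianProductWith : ∀ {c} {C : Set c} (f : A → B → C) xs ys h →
  ∑ℕ (cartesianProductWith f xs ys) h ≡ ∑ℕ xs (λ x → ∑ℕ ys (λ y → h (f x y)))
∑ℕ-cartesianProductWith f []       ys h = refl
∑ℕ-cartesianProductWith f (x ∷ xs) ys h = trans (∑ℕ-++ (map (f x) ys) _ h)
  (cong₂ _+_ (∑ℕ-map (f x) ys h) (∑ℕ-cartesianProductWith f xs ys h))

∑ℕ-+ : ∀ (xs : List A) h h′ → ∑ℕ xs (λ x → h x + h′ x) ≡ ∑ℕ xs h + ∑ℕ xs h′
∑ℕ-+ []       h h′ = refl
∑ℕ-+ (x ∷ xs) h h′ rewrite ∑ℕ-+ xs h h′ = interchange (h x) (h′ x) _ _

∑ℕ-*ˡ : ∀ (xs : List A) m h → ∑ℕ xs (λ x → m * h x) ≡ m * ∑ℕ xs h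
∑ℕ-*ˡ []       m h = sym (*-zeroʳ m)
∑ℕ-*ˡ (x ∷ xs) m h rewrite ∑ℕ-*ˡ xs m h = sym (*-distribˡ-+ m (h x) _)

∑ℕ-0 : ∀ (xs : List A) → ∑ℕ xs (λ _ → 0) ≡ 0
∑ℕ-0 []       = refl
∑ℕ-0 (x ∷ xs) = ∑ℕ-0 xs

∑ℕ-swap : ∀ (xs : List A) (ys : List B) (h : A → B → ℕ) →
          ∑ℕ xs (λ x → ∑ℕ ys (h x)) ≡ ∑ℕ ys (λ y → ∑ℕ xs (λ x → h x y))
∑ℕ-swap []       ys h = sym (∑ℕ-0 ys)
∑ℕ-swap (x ∷ xs) ys h = trans (cong (∑ℕ ys (h x) +_) (∑ℕ-swap xs ys h)) (sym (∑ℕ-+ ys (h x) _))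

-- Insertion of equal letters into a word

descents : List ℕ → ℕ
descents []          = 0
descents (x ∷ [])    = 0
descents (x ∷ y ∷ w) = (if does (y <? x) then 1 else 0) + descents (y ∷ w)

rises : List ℕ → ℕ
rises []          = 0
rises (x ∷ [])    = 0
rises (x ∷ y ∷ w) = (if does (y <? x) then 0 else 1) + rises (y ∷ w)

rises+descents : ∀ x w → rises (x ∷ w) + descents (x ∷ w) ≡ length w
rises+descents x []      = refl
rises+descents x (y ∷ w) with does (y <? x)
... | false = cong suc (rises+descents y w)
... | true  = trans (+-suc (rises (y ∷ w)) _) (cong suc (rises+descents y w))

descents-0∷ : ∀ w → descents (0 ∷ w) ≡ descents w
descents-0∷ []      = refl
descents-0∷ (y ∷ w) = refl

insertions : ℕ → ℕ → List ℕ → List (List ℕ)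
insertions t zero    w       = w ∷ []
insertions t (suc k) []      = map (t ∷_) (insertions t k [])
insertions t (suc k) (x ∷ w) = map (t ∷_) (insertions t k (x ∷ w)) ++ map (x ∷_) (insertions t (suc k) w)

-- In `q`, the first factor is supported from E + e on and the second on [E, E + e]; at the common
-- point both are 1.
choose-point : ∀ c e q E → choose c q (E + e) * choose e q E ≡ δ q (E + e)
choose-point c e q E with <-cmp q (E + e)
... | tri< q< _ _ rewrite choose-low c q< = sym (δ-≢ (<⇒≢ q<))
... | tri≈ _ refl _ rewrite choose-bottom c (E + e) | choose-top e E = sym (δ-refl (E + e))
... | tri> _ _ q> rewrite choose-high e {q} {E} q> = trans (*-zeroʳ (choose c q (E + e))) (sym (δ-≢ (>⇒≢ q>)))

module _ (t q : ℕ) where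

  insertions-[] : ∀ k x E → x ≤ t →
                  ∑ℕ (insertions t k []) (λ w → δ q (E + descents (x ∷ w))) ≡ δ q E
  insertions-[] zero    x E x≤t = trans (+-identityʳ _) (cong (δ q) (+-identityʳ E))
  insertions-[] (suc k) x E x≤t rewrite ∑ℕ-map (t ∷_) (insertions t k []) (λ w → δ q (E + descents (x ∷ w)))
    | dec-false (t <? x) (≤⇒≯ x≤t) = insertions-[] k t E ≤-refl

  -- A word with c rises and e descents gives choose c q (E + e) * choose (k + e) q E: choose the set of
  -- rises turned into descents and distribute the remaining copies over the gaps where they do not
  -- matter. After a copy of t, the next letter is always a descent.

  insertions-after-letter : ∀ k x w E → x ≤ t → All (_< t) w →
      ∑ℕ (insertions t k w) (λ v → δ q (E + descents (x ∷ v)))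
    ≡ choose (rises (x ∷ w)) q (E + descents (x ∷ w)) * choose (k + descents (x ∷ w)) q E
  insertions-after-top : ∀ k x w E → x < t → All (_< t) w →
      ∑ℕ (insertions t k (x ∷ w)) (λ v → δ q (E + descents (t ∷ v)))
    ≡ choose (rises (x ∷ w)) q (E + suc (descents (x ∷ w))) * choose (k + suc (descents (x ∷ w))) q E

  insertions-after-letter zero    x w       E x≤t w<t =
    trans (+-identityʳ _) (sym (choose-point (rises (x ∷ w)) (descents (x ∷ w)) q E))
  insertions-after-letter (suc k) x []      E x≤t w<t = trans (insertions-[] (suc k) x E x≤t) (δ-choose (suc k + 0) E)
    where
    δ-choose : ∀ c E → δ q E ≡ δ q (E + 0) * choose c q E
    δ-choose c E rewrite +-identityʳ E with q ≟ E
    ... | yes refl rewrite choose-bottom c q = sym (*-identityʳ (δ q q))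
    ... | no  q≢E  rewrite δ-≢ q≢E = refl
  insertions-after-letter (suc k) x (y ∷ w) E x≤t (y<t ∷ w<t)
    rewrite ∑ℕ-++ (map (t ∷_) (insertions t k (y ∷ w))) (map (y ∷_) (insertions t (suc k) w)) (λ v → δ q (E + descents (x ∷ v)))
          | ∑ℕ-map (t ∷_) (insertions t k (y ∷ w)) (λ v → δ q (E + descents (x ∷ v)))
          | ∑ℕ-map (y ∷_) (insertions t (suc k) w) (λ v → δ q (E + descents (x ∷ v)))
          | dec-false (t <? x) (≤⇒≯ x≤t)
          | insertions-after-top k y w E y<t w<t
    with does (y <? x)
  ... | true
    rewrite ∑ℕ-cong (insertions t (suc k) w) {λ v → δ q (E + suc (descents (y ∷ v)))} (λ v → cong (δ q) (+-suc E _))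
          | insertions-after-letter (suc k) y w (suc E) (<⇒≤ y<t) w<t
          | +-suc E (descents (y ∷ w)) | +-suc k (descents (y ∷ w)) =
    sym (*-distribˡ-+ (choose (rises (y ∷ w)) q (suc (E + descents (y ∷ w)))) _ _)
  ... | false
    rewrite insertions-after-letter (suc k) y w E (<⇒≤ y<t) w<t
          | +-suc E (descents (y ∷ w)) | +-suc k (descents (y ∷ w)) =
    trans (+-comm (choose (rises (y ∷ w)) q (suc (E + descents (y ∷ w))) * choose (suc (k + descents (y ∷ w))) q E) _)
      (sym (*-distribʳ-+ (choose (suc (k + descents (y ∷ w))) q E) (choose (rises (y ∷ w)) q (E + descents (y ∷ w))) _))
  insertions-after-top zero    x w E x<t w<t rewrite dec-true (x <? t) x<t =
    trans (+-identityʳ _) (sym (choose-point (rises (x ∷ w)) (suc (descents (x ∷ w))) q E))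
  insertions-after-top (suc k) x w E x<t w<t
    rewrite ∑ℕ-++ (map (t ∷_) (insertions t k (x ∷ w))) (map (x ∷_) (insertions t (suc k) w)) (λ v → δ q (E + descents (t ∷ v)))
          | ∑ℕ-map (t ∷_) (insertions t k (x ∷ w)) (λ v → δ q (E + descents (t ∷ v)))
          | ∑ℕ-map (x ∷_) (insertions t (suc k) w) (λ v → δ q (E + descents (t ∷ v)))
          | dec-false (t <? t) (n≮n t)
          | dec-true (x <? t) x<t
          | insertions-after-top k x w E x<t w<t
          | ∑ℕ-cong (insertions t (suc k) w) {λ v → δ q (E + suc (descents (x ∷ v)))} (λ v → cong (δ q) (+-suc E _))
          | insertions-after-letter (suc k) x w (suc E) (<⇒≤ x<t) w<t
          | +-suc E (descents (x ∷ w)) | +-suc k (descents (x ∷ w)) =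
    sym (*-distribˡ-+ (choose (rises (x ∷ w)) q (suc (E + descents (x ∷ w)))) _ _)

  -- A letter 0 in front creates no descent and makes the start of the word an ordinary weak rise.
  -- The rises are then the letters that are not the lower end of a descent.
  insertions-δ : ∀ k w → All (_< t) w →
      ∑ℕ (insertions t k w) (δ q ∘ descents)
    ≡ choose (length w ∸ descents w) q (descents w) * choose (k + descents w) q 0
  insertions-δ k w w<t = begin
    ∑ℕ (insertions t k w) (δ q ∘ descents)
      ≡⟨ ∑ℕ-cong (insertions t k w) (λ v → cong (δ q) (sym (descents-0∷ v))) ⟩
    ∑ℕ (insertions t k w) (λ v → δ q (descents (0 ∷ v)))
      ≡⟨ insertions-after-letter k 0 w 0 z≤n w<t ⟩
    choose (rises (0 ∷ w)) q (descents (0 ∷ w)) * choose (k + descents (0 ∷ w)) q 0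
      ≡⟨ cong₂ (λ c e → choose c q e * choose (k + e) q 0) rises≡ (descents-0∷ w) ⟩
    choose (length w ∸ descents w) q (descents w) * choose (k + descents w) q 0
      ∎
    where
    open ≡-Reasoning
    rises≡ : rises (0 ∷ w) ≡ length w ∸ descents w
    rises≡ = trans (sym (m+n∸n≡m _ (descents (0 ∷ w)))) (cong₂ _∸_ (rises+descents 0 w) (descents-0∷ w))

-- Enumerations

module _ {P : Pred A p} {Q : Pred A q} where

  -- Sums and cardinalities thus depend on the predicate alone, and any convenient enumeration may
  -- be used to compute them.
  elements-↭ : (E : Enumeration P) (F : Enumeration Q) →
               (∀ {x} → P x → Q x) → (∀ {x} → Q x → P x) → E .elements ↭ F .elements
  elements-↭ E F P⇒Q Q⇒P = ∼bag⇒↭ (unique∧set⇒bag (E .unique) (F .unique)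
    (mk⇔ (F .complete ∘ P⇒Q ∘ E .sound) (E .complete ∘ Q⇒P ∘ F .sound)))

  transfer : (∀ {x} → P x → Q x) → (∀ {x} → Q x → P x) → Enumeration P → Enumeration Q
  transfer P⇒Q Q⇒P E = record
    { elements = E .elements
    ; unique   = E .unique
    ; sound    = P⇒Q ∘ E .sound
    ; complete = E .complete ∘ Q⇒P
    }

module _ {A : Set a} {B : Set b} (f : A → List B) (g : B → A) where

  concatMap-unique : ∀ {xs} → Unique xs → (∀ {x} → x ∈ xs → Unique (f x)) →
                     (∀ {x y} → x ∈ xs → y ∈ f x → g y ≡ x) → Unique (concatMap f xs)
  concatMap-unique {[]}     _                 _   _   = []
  concatMap-unique {x ∷ xs} x∷xs!@(_ ∷ xs!) fx! ret = Unique.++⁺ (fx! (here refl))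
    (concatMap-unique xs! (fx! ∘ there) (ret ∘ there)) disjoint
    where
    disjoint : ∀ {y} → y ∈ f x × y ∈ concatMap f xs → _
    disjoint (y∈fx , y∈) with find (∈-concatMap⁻ f {xs = xs} y∈)
    ... | x′ , x′∈ , y∈fx′ = Unique.Unique[x∷xs]⇒x∉xs x∷xs!
      (subst (_∈ xs) (trans (sym (ret (there x′∈) y∈fx′)) (ret (here refl) y∈fx)) x′∈)

  -- The common scheme for adding nodes, inserting letters and turning children: `g` forgets what
  -- `f` adds. As `g` recovers `x` from every member of `f x`, different fibres are disjoint.
  fibred : {P : Pred A p} {Q : Pred B q} → Enumeration P →
           (∀ {x} → P x → Unique (f x)) →
           (∀ {x y} → P x → y ∈ f x → g y ≡ x × Q y) →
           (∀ {y} → Q y → P (g y) × y ∈ f (g y)) →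
           Enumeration Q
  fibred E f-unique f-sound f-complete = record
    { elements = concatMap f (E .elements)
    ; unique   = concatMap-unique (E .unique) (f-unique ∘ E .sound) (λ x∈ → proj₁ ∘ f-sound (E .sound x∈))
    ; sound    = λ y∈ → let x , x∈ , y∈fx = find (∈-concatMap⁻ f {xs = E .elements} y∈) in proj₂ (f-sound (E .sound x∈) y∈fx)
    ; complete = λ q → let p , y∈ = f-complete q in ∈-concatMap⁺ f (lose (E .complete p) y∈)
    }

-- Multisets by occurrences, and splittings of a number

occ : ℕ → List ℕ → ℕ
occ i xs = ∑ℕ xs (δ i)

∈⇒occ : ∀ {i xs} → i ∈ xs → 0 < occ i xs
∈⇒occ {i} (here refl) rewrite δ-refl i = z<s
∈⇒occ {i} {x ∷ xs} (there i∈) = ≤-trans (∈⇒occ i∈) (m≤n+m _ (δ i x))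

occ⇒∈ : ∀ i xs → 0 < occ i xs → i ∈ xs
occ⇒∈ i (x ∷ xs) pos with i ≟ x
... | yes refl = here refl
... | no  i≢x  rewrite δ-≢ i≢x = there (occ⇒∈ i xs pos)

occ-≡⇒↭ : ∀ xs ys → (∀ i → occ i xs ≡ occ i ys) → xs ↭ ys
occ-≡⇒↭ []       []       eq = ↭-refl
occ-≡⇒↭ []       (y ∷ ys) eq = contradiction (eq y) (<⇒≢ (∈⇒occ {y} {y ∷ ys} (here refl)))
occ-≡⇒↭ (x ∷ xs) ys       eq with ∈-∃++ (occ⇒∈ x ys (subst (0 <_) (eq x) (∈⇒occ {x} {x ∷ xs} (here refl))))
... | us , vs , refl = ↭-trans
  (prep x (occ-≡⇒↭ xs (us ++ vs) λ i → +-cancelˡ-≡ (δ i x) _ _ (trans (eq i) (∑ℕ-↭ (δ i) (shift x us vs)))))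
  (↭-sym (shift x us vs))

occ-replicate : ∀ i k j → occ i (List.replicate k j) ≡ k * δ i j
occ-replicate i zero    j = refl
occ-replicate i (suc k) j = cong (δ i j +_) (occ-replicate i k j)

splits : ℕ → List (ℕ × ℕ)
splits zero    = [ 0 , 0 ]
splits (suc k) = (0 , suc k) ∷ map (map₁ suc) (splits k)

splits-sound : ∀ k {i j} → (i , j) ∈ splits k → i + j ≡ k
splits-sound zero    (here refl) = refl
splits-sound (suc k) (here refl) = refl
splits-sound (suc k) (there p∈) with _ , q∈ , refl ← ∈-map⁻ (map₁ suc) p∈ = cong suc (splits-sound k q∈)

splits-complete : ∀ i j → (i , j) ∈ splits (i + j)
splits-complete zero    zero    = here refl
splits-complete zero    (suc j) = here refl
splits-complete (suc i) j       = there (∈-map⁺ (map₁ suc) (splits-complete i j))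

splits-unique : ∀ k → Unique (splits k)
splits-unique zero    = [] ∷ []
splits-unique (suc k) =
  All.tabulate (λ p∈ eq → 0≢suc (subst (_∈ map (map₁ suc) (splits k)) (sym eq) p∈)) ∷ Unique.map⁺ (λ { refl → refl }) (splits-unique k)
  where
  0≢suc : ∀ {j} → (0 , j) ∉ map (map₁ suc) (splits k)
  0≢suc p∈ with _ , _ , () ← ∈-map⁻ (map₁ suc) p∈

-- Nodes placed in two separate groups of slots, such as those of two subtrees, do not interact. In
-- the merged group the left slots of both come before all right ones, hence `place-right` once the
-- first group has only right slots left.
place-convolution : ∀ k ℓ r ℓ′ r′ (h : ℕ → ℕ → ℕ) →
    ∑ℕ (splits k) (λ (i , j) → place i ℓ r (λ x y → place j ℓ′ r′ (λ x′ y′ → h (x + x′) (y + y′))))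
  ≡ place k (ℓ + ℓ′) (r + r′) h
place-convolution zero    ℓ       r       ℓ′ r′ h = +-identityʳ _
place-convolution (suc k) zero    zero    ℓ′ r′ h =
  trans (cong (place (suc k) ℓ′ r′ h +_) (trans (∑ℕ-map (map₁ suc) (splits k) _) (∑ℕ-0 (splits k)))) (+-identityʳ _)
place-convolution (suc k) zero    (suc r) ℓ′ r′ h = begin
  p₀ + ∑ℕ (map (map₁ suc) (splits k)) g
    ≡⟨ cong (p₀ +_) (∑ℕ-map (map₁ suc) (splits k) g) ⟩
  p₀ + ∑ℕ (splits k) (λ (i , j) → place (suc i) 0 r (λ x y → u j x (suc y)) + place i 1 (suc r) (u j))
    ≡⟨ cong (p₀ +_) (∑ℕ-+ (splits k) _ _) ⟩
  p₀ + (∑ℕ (splits k) (λ (i , j) → place (suc i) 0 r (λ x y → u j x (suc y))) + ∑ℕ (splits k) (λ (i , j) → place i 1 (suc r) (u j)))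
    ≡⟨ +-assoc p₀ _ _ ⟨
  p₀ + ∑ℕ (splits k) (λ (i , j) → place (suc i) 0 r (λ x y → u j x (suc y))) + ∑ℕ (splits k) (λ (i , j) → place i 1 (suc r) (u j))
    ≡⟨ cong₂ _+_ (cong (p₀ +_) (sym (∑ℕ-map (map₁ suc) (splits k) _))) (place-convolution k 1 (suc r) ℓ′ r′ h) ⟩
  ∑ℕ (splits (suc k)) (λ (i , j) → place i 0 r (λ x y → u j x (suc y))) + place k (suc ℓ′) (suc r + r′) h
    ≡⟨ cong (_+ place k (suc ℓ′) (suc r + r′) h) (place-convolution (suc k) 0 r ℓ′ r′ (λ x y → h x (suc y))) ⟩
  place (suc k) ℓ′ (r + r′) (λ x y → h x (suc y)) + place k (suc ℓ′) (suc r + r′) h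
    ≡⟨ place-right k ℓ′ (r + r′) h ⟨
  place (suc k) ℓ′ (suc r + r′) h
    ∎
  where
  open ≡-Reasoning
  u : ℕ → ℕ → ℕ → ℕ
  u j x y = place j ℓ′ r′ (λ x′ y′ → h (x + x′) (y + y′))
  g : ℕ × ℕ → ℕ
  g (i , j) = place i 0 (suc r) (u j)
  p₀ = u (suc k) 0 (suc r)
place-convolution (suc k) (suc ℓ) r       ℓ′ r′ h = begin
  p₀ + ∑ℕ (map (map₁ suc) (splits k)) g
    ≡⟨ cong (p₀ +_) (∑ℕ-map (map₁ suc) (splits k) g) ⟩
  p₀ + ∑ℕ (splits k) (λ (i , j) → place (suc i) ℓ r (λ x y → u j (suc x) y) + place i (suc ℓ) (suc r) (u j))
    ≡⟨ cong (p₀ +_) (∑ℕ-+ (splits k) _ _) ⟩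
  p₀ + (∑ℕ (splits k) (λ (i , j) → place (suc i) ℓ r (λ x y → u j (suc x) y)) + ∑ℕ (splits k) (λ (i , j) → place i (suc ℓ) (suc r) (u j)))
    ≡⟨ +-assoc p₀ _ _ ⟨
  p₀ + ∑ℕ (splits k) (λ (i , j) → place (suc i) ℓ r (λ x y → u j (suc x) y)) + ∑ℕ (splits k) (λ (i , j) → place i (suc ℓ) (suc r) (u j))
    ≡⟨ cong₂ _+_ (cong (p₀ +_) (sym (∑ℕ-map (map₁ suc) (splits k) _))) (place-convolution k (suc ℓ) (suc r) ℓ′ r′ h) ⟩
  ∑ℕ (splits (suc k)) (λ (i , j) → place i ℓ r (λ x y → u j (suc x) y)) + place k (suc ℓ + ℓ′) (suc r + r′) h
    ≡⟨ cong (_+ place k (suc ℓ + ℓ′) (suc r + r′) h) (place-convolution (suc k) ℓ r ℓ′ r′ (λ x y → h (suc x) y)) ⟩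
  place (suc k) (suc ℓ + ℓ′) (r + r′) h
    ∎
  where
  open ≡-Reasoning
  u : ℕ → ℕ → ℕ → ℕ
  u j x y = place j ℓ′ r′ (λ x′ y′ → h (x + x′) (y + y′))
  g : ℕ × ℕ → ℕ
  g (i , j) = place i (suc ℓ) r (u j)
  p₀ = u (suc k) (suc ℓ) r

-- Forests as binary trees

-- A forest is read as a binary tree: the left subtree of node j ts ∷ us is ts and the right one us.
-- Then leavesF counts the free left slots. The child versions count slots of a left subtree, which
-- leaves a free left slot if it is empty.

rightSlots : List Tree → ℕ
rightSlots []                   = 1
rightSlots (node _ []       ∷ ts) = rightSlots ts
rightSlots (node _ (u ∷ us) ∷ ts) = rightSlots (u ∷ us) + rightSlots ts

childLeft : List Tree → ℕ
childLeft []       = 1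
childLeft (t ∷ ts) = leavesF (t ∷ ts)

childRight : List Tree → ℕ
childRight []       = 0
childRight (t ∷ ts) = rightSlots (t ∷ ts)

leavesF-node : ∀ j ts us → leavesF (node j ts ∷ us) ≡ childLeft ts + leavesF us
leavesF-node j []       us = refl
leavesF-node j (t ∷ ts) us = refl

rightSlots-node : ∀ j ts us → rightSlots (node j ts ∷ us) ≡ childRight ts + rightSlots us
rightSlots-node j []       us = refl
rightSlots-node j (t ∷ ts) us = refl

slots : ∀ ts → leavesF ts + rightSlots ts ≡ suc (length (labelsF ts))
childSlots : ∀ ts → childLeft ts + childRight ts ≡ suc (length (labelsF ts))

slots []              = refl
slots (node j ts ∷ us)
  rewrite leavesF-node j ts us | rightSlots-node j ts us | length-++ (labelsF ts) {labelsF us} = begin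
  (childLeft ts + leavesF us) + (childRight ts + rightSlots us)  ≡⟨ interchange (childLeft ts) _ _ _ ⟩
  (childLeft ts + childRight ts) + (leavesF us + rightSlots us)  ≡⟨ cong₂ _+_ (childSlots ts) (slots us) ⟩
  suc (length (labelsF ts)) + suc (length (labelsF us))          ≡⟨ +-suc (suc (length (labelsF ts))) _ ⟩
  suc (suc (length (labelsF ts) + length (labelsF us)))          ∎
  where
  open ≡-Reasoning
childSlots []       = refl
childSlots (t ∷ ts) = slots (t ∷ ts)

graft : ℕ → List Tree → List Tree → List Tree
graft j ts us = node j ts ∷ us

-- fill t n r ts lists the forests obtained by adding r nodes labelled t at the bottom of ts (for
-- r ≤ n; n makes the recursion structural).

fill : ℕ → ℕ → ℕ → List Tree → List (List Tree)
fill t n       r       (node j ts ∷ us) =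
  concatMap (λ (r₁ , r₂) → cartesianProductWith (graft j) (fill t n r₁ ts) (fill t n r₂ us)) (splits r)
fill t n       zero    []               = [ [] ]
fill t zero    (suc r) []               = []
fill t (suc n) (suc r) []               = fill t n r (node t [] ∷ [])

module _ (t : ℕ) where

  ∑-fill-node : ∀ n r j ts us h →
      ∑ℕ (fill t n r (node j ts ∷ us)) h
    ≡ ∑ℕ (splits r) (λ (r₁ , r₂) → ∑ℕ (fill t n r₁ ts) (λ ts′ → ∑ℕ (fill t n r₂ us) (λ us′ → h (node j ts′ ∷ us′))))
  ∑-fill-node n r j ts us h = trans (∑ℕ-concatMap _ (splits r) h)
    (∑ℕ-cong (splits r) (λ (r₁ , r₂) → ∑ℕ-cartesianProductWith (graft j) (fill t n r₁ ts) (fill t n r₂ us) h))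

  ∑-fill : ∀ n r ts (h : ℕ → ℕ → ℕ) → r ≤ n →
    ∑ℕ (fill t n r ts) (λ ts′ → h (leavesF ts′) (rightSlots ts′)) ≡ place r (leavesF ts) (rightSlots ts) h
  ∑-fill-child : ∀ n r ts (h : ℕ → ℕ → ℕ) → r ≤ n →
    ∑ℕ (fill t n r ts) (λ ts′ → h (childLeft ts′) (childRight ts′)) ≡ place r (childLeft ts) (childRight ts) h

  ∑-fill n       zero    []               h _         = +-identityʳ (h 0 1)
  ∑-fill (suc n) (suc r) []               h (s≤s r≤n) = ∑-fill n r (node t [] ∷ []) h r≤n
  ∑-fill n       r       (node j ts ∷ us) h r≤n = begin
    ∑ℕ (fill t n r (node j ts ∷ us)) (λ ts′ → h (leavesF ts′) (rightSlots ts′))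
      ≡⟨ ∑-fill-node n r j ts us _ ⟩
    ∑ℕ (splits r) (λ (r₁ , r₂) → ∑ℕ (fill t n r₁ ts) (λ ts′ → ∑ℕ (fill t n r₂ us) (λ us′ → h (leavesF (node j ts′ ∷ us′)) (rightSlots (node j ts′ ∷ us′)))))
      ≡⟨ ∑ℕ-cong-∈ (splits r) split ⟩
    ∑ℕ (splits r) (λ (r₁ , r₂) → place r₁ (childLeft ts) (childRight ts) (λ x y → place r₂ (leavesF us) (rightSlots us) (λ x′ y′ → h (x + x′) (y + y′))))
      ≡⟨ place-convolution r (childLeft ts) (childRight ts) (leavesF us) (rightSlots us) h ⟩
    place r (childLeft ts + leavesF us) (childRight ts + rightSlots us) h
      ≡⟨ cong₂ (λ x y → place r x y h) (leavesF-node j ts us) (rightSlots-node j ts us) ⟨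
    place r (leavesF (node j ts ∷ us)) (rightSlots (node j ts ∷ us)) h
      ∎
    where
    open ≡-Reasoning
    split : ∀ {s} → s ∈ splits r →
        ∑ℕ (fill t n (proj₁ s) ts) (λ ts′ → ∑ℕ (fill t n (proj₂ s) us) (λ us′ → h (leavesF (node j ts′ ∷ us′)) (rightSlots (node j ts′ ∷ us′))))
      ≡ place (proj₁ s) (childLeft ts) (childRight ts) (λ x y → place (proj₂ s) (leavesF us) (rightSlots us) (λ x′ y′ → h (x + x′) (y + y′)))
    split {r₁ , r₂} s∈ with splits-sound r s∈
    ... | refl = trans
      (∑ℕ-cong (fill t n r₁ ts) (λ ts′ → trans
        (∑ℕ-cong (fill t n r₂ us) (λ us′ → cong₂ h (leavesF-node j ts′ us′) (rightSlots-node j ts′ us′)))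
        (∑-fill n r₂ us (λ x′ y′ → h (childLeft ts′ + x′) (childRight ts′ + y′)) (≤-trans (m≤n+m r₂ r₁) r≤n))))
      (∑-fill-child n r₁ ts (λ x y → place r₂ (leavesF us) (rightSlots us) (λ x′ y′ → h (x + x′) (y + y′))) (≤-trans (m≤m+n r₁ r₂) r≤n))

  ∑-fill-child n       zero    []               h _         = +-identityʳ (h 1 0)
  ∑-fill-child (suc n) (suc r) []               h (s≤s r≤n) = ∑-fill-child n r (node t [] ∷ []) h r≤n
  ∑-fill-child n       r       (node j ts ∷ us) h r≤n = trans
    (trans (∑-fill-node n r j ts us (λ ts′ → h (childLeft ts′) (childRight ts′)))
      (sym (∑-fill-node n r j ts us (λ ts′ → h (leavesF ts′) (rightSlots ts′)))))
    (∑-fill n r (node j ts ∷ us) h r≤n)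

-- Ordered u l ts: as a binary tree, ts is weakly increasing with labels in [l, u).

data Ordered (u : ℕ) : ℕ → List Tree → Set where
  []   : ∀ {l} → Ordered u l []
  node : ∀ {l j ts us} → l ≤ j → j < u → Ordered u j ts → Ordered u j us → Ordered u l (node j ts ∷ us)

-- Meant for `t` the largest label: everything below a node labelled `t` in the binary tree, its
-- later siblings included, is then labelled `t` too, so the whole binary subtree is cut off.
prune : ℕ → List Tree → List Tree
prune t []               = []
prune t (node j ts ∷ us) with j ≟ t
... | yes _ = []
... | no  _ = node j (prune t ts) ∷ prune t us

prune-top : ∀ {t ts} → Ordered (suc t) t ts → prune t ts ≡ []
prune-top                       []                       = refl
prune-top {t} {node j _ ∷ _} (node t≤j j<1+t _ _) with j ≟ t
... | yes _   = refl
... | no  j≢t = contradiction (≤-antisym (≤-pred j<1+t) t≤j) j≢t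

prune-id : ∀ {t l ts} → Ordered t l ts → prune t ts ≡ ts
prune-id                       []              = refl
prune-id {t} {ts = node j _ ∷ _} (node _ j<t o o′) with j ≟ t
... | yes refl = contradiction j<t (n≮n j)
... | no  _    = cong₂ (graft j) (prune-id o) (prune-id o′)

prune-ordered : ∀ {t l ts} → Ordered (suc t) l ts → Ordered t l (prune t ts)
prune-ordered                       []                     = []
prune-ordered {t} {ts = node j _ ∷ _} (node l≤j j<1+t o o′) with j ≟ t
... | yes _   = []
... | no  j≢t = node l≤j (≤∧≢⇒< (≤-pred j<1+t) j≢t) (prune-ordered o) (prune-ordered o′)

ordered-suc : ∀ {u l ts} → Ordered u l ts → Ordered (suc u) l ts
ordered-suc []                = []
ordered-suc (node l≤j j<u o o′) = node l≤j (m<n⇒m<1+n j<u) (ordered-suc o) (ordered-suc o′)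

occF : ℕ → List Tree → ℕ
occF i ts = occ i (labelsF ts)

occF-node : ∀ i j ts us → occF i (node j ts ∷ us) ≡ δ i j + (occF i ts + occF i us)
occF-node i j ts us = cong (δ i j +_) (∑ℕ-++ (labelsF ts) (labelsF us) (δ i))

module _ (t : ℕ) where

  ∈-fill-node⁻ : ∀ n r j ts us {vs} → vs ∈ fill t n r (node j ts ∷ us) →
    ∃₂ λ ts′ us′ → ∃₂ λ r₁ r₂ →
      vs ≡ node j ts′ ∷ us′ × r₁ + r₂ ≡ r × ts′ ∈ fill t n r₁ ts × us′ ∈ fill t n r₂ us
  ∈-fill-node⁻ n r j ts us vs∈
    with (r₁ , r₂) , s∈ , vs∈′ ← find (∈-concatMap⁻ _ {xs = splits r} vs∈)
    with ts′ , us′ , ts∈ , us∈ , refl ← ∈-cartesianProductWith⁻ (graft j) (fill t n r₁ ts) (fill t n r₂ us) vs∈′ =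
    ts′ , us′ , r₁ , r₂ , refl , splits-sound r s∈ , ts∈ , us∈

  fill-occ : ∀ n r ts {ts′} → ts′ ∈ fill t n r ts → ∀ i → occF i ts′ ≡ occF i ts + r * δ i t
  fill-occ n       zero    []               (here refl) i = refl
  fill-occ (suc n) (suc r) []               ts∈         i =
    trans (fill-occ n r (node t [] ∷ []) ts∈ i) (cong (_+ r * δ i t) (+-identityʳ (δ i t)))
  fill-occ n       r       (node j ts ∷ us) vs∈         i
    with ts′ , us′ , r₁ , r₂ , refl , refl , ts∈ , us∈ ← ∈-fill-node⁻ n r j ts us vs∈
    rewrite occF-node i j ts′ us′ | occF-node i j ts us | fill-occ n r₁ ts ts∈ i | fill-occ n r₂ us us∈ i =
    regroup (δ i j) (occF i ts) (occF i us) r₁ r₂ (δ i t)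
    where
    regroup : ∀ d x y r₁ r₂ e → d + ((x + r₁ * e) + (y + r₂ * e)) ≡ d + (x + y) + (r₁ + r₂) * e
    regroup = solve-∀

  fill-ordered : ∀ n r {ts ts′ l} → ts′ ∈ fill t n r ts → l ≤ t → Ordered (suc t) l ts → Ordered (suc t) l ts′
  fill-ordered n       zero    {[]}             (here refl) l≤t o = []
  fill-ordered (suc n) (suc r) {[]}             ts∈         l≤t o =
    fill-ordered n r {node t [] ∷ []} ts∈ l≤t (node l≤t (n<1+n t) [] [])
  fill-ordered n       r       {node j ts ∷ us} vs∈         l≤t (node l≤j j<1+t o o′)
    with ts′ , us′ , r₁ , r₂ , refl , _ , ts∈ , us∈ ← ∈-fill-node⁻ n r j ts us vs∈ =
    node l≤j j<1+t (fill-ordered n r₁ ts∈ (≤-pred j<1+t) o) (fill-ordered n r₂ us∈ (≤-pred j<1+t) o′)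

  fill-prune : ∀ n r ts {ts′} → ts′ ∈ fill t n r ts → prune t ts′ ≡ prune t ts
  fill-prune n       zero    []               (here refl) = refl
  fill-prune (suc n) (suc r) []               ts∈ with eq ← fill-prune n r (node t [] ∷ []) ts∈ | t ≟ t
  ... | yes _   = eq
  ... | no  t≢t = contradiction refl t≢t
  fill-prune n       r       (node j ts ∷ us) vs∈
    with ts′ , us′ , r₁ , r₂ , refl , _ , ts∈ , us∈ ← ∈-fill-node⁻ n r j ts us vs∈
    with j ≟ t
  ... | yes _ = refl
  ... | no  _ = cong₂ (graft j) (fill-prune n r₁ ts ts∈) (fill-prune n r₂ us us∈)

  fill-unique : ∀ n r ts → Unique (fill t n r ts)
  fill-unique n       zero    []               = [] ∷ []
  fill-unique zero    (suc r) []               = []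
  fill-unique (suc n) (suc r) []               = fill-unique n r (node t [] ∷ [])
  fill-unique n       r       (node j ts ∷ us) = concatMap-unique _ added (splits-unique r)
    (λ {(r₁ , r₂)} _ → Unique.cartesianProductWith⁺ (graft j) (λ { refl → refl , refl }) (fill-unique n r₁ ts) (fill-unique n r₂ us))
    (λ {(r₁ , r₂)} _ vs∈ → retract r₁ r₂ vs∈)
    where
    -- The splitting of `r` is recovered by counting how many labels `t` each subtree has gained,
    -- which keeps the lists for different splittings disjoint.
    added : List Tree → ℕ × ℕ
    added []               = 0 , 0
    added (node _ ts′ ∷ us′) = occF t ts′ ∸ occF t ts , occF t us′ ∸ occF t us
    difference : ∀ r vs {vs′} → vs′ ∈ fill t n r vs → occF t vs′ ∸ occF t vs ≡ r
    difference r vs vs∈ rewrite fill-occ n r vs vs∈ t | δ-refl t | *-identityʳ r = m+n∸m≡n (occF t vs) r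
    retract : ∀ r₁ r₂ {vs} → vs ∈ cartesianProductWith (graft j) (fill t n r₁ ts) (fill t n r₂ us) → added vs ≡ (r₁ , r₂)
    retract r₁ r₂ vs∈ with ts′ , us′ , ts∈ , us∈ , refl ← ∈-cartesianProductWith⁻ (graft j) (fill t n r₁ ts) (fill t n r₂ us) vs∈ =
      cong₂ _,_ (difference r₁ ts ts∈) (difference r₂ us us∈)

  ∈-fill-node⁺ : ∀ n r₁ r₂ j ts us {ts′ us′} → ts′ ∈ fill t n r₁ ts → us′ ∈ fill t n r₂ us →
                 node j ts′ ∷ us′ ∈ fill t n (r₁ + r₂) (node j ts ∷ us)
  ∈-fill-node⁺ n r₁ r₂ j ts us ts∈ us∈ =
    ∈-concatMap⁺ _ (lose (splits-complete r₁ r₂) (∈-cartesianProductWith⁺ (graft j) ts∈ us∈))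

  fill-complete : ∀ n {l ts} → Ordered (suc t) l ts → occF t ts ≤ n → ts ∈ fill t n (occF t ts) (prune t ts)
  fill-complete n []                                     _ = here refl
  fill-complete n {ts = node j ts ∷ us} (node _ _ o o′) occ≤n
    rewrite occF-node t j ts us with j ≟ t
  ... | no  j≢t rewrite δ-≢ (j≢t ∘ sym) = ∈-fill-node⁺ n (occF t ts) (occF t us) j (prune t ts) (prune t us)
    (fill-complete n o (≤-trans (m≤m+n _ _) occ≤n)) (fill-complete n o′ (≤-trans (m≤n+m _ _) occ≤n))
  -- The root is itself an added node, so it was put into an empty slot at the cost of one unit of
  -- `n`. Both subtrees consist of added nodes only and are pruned to `[]`.
  ... | yes refl rewrite δ-refl t with n | occ≤n
  ...   | suc n | s≤s occ≤n = ∈-fill-node⁺ n (occF t ts) (occF t us) t [] []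
    (subst (λ vs → ts ∈ fill t n (occF t ts) vs) (prune-top o) (fill-complete n o (≤-trans (m≤m+n _ _) occ≤n)))
    (subst (λ vs → us ∈ fill t n (occF t us) vs) (prune-top o′) (fill-complete n o′ (≤-trans (m≤n+m _ _) occ≤n)))

record Forest (M : List ℕ) (u : ℕ) (ts : List Tree) : Set where
  constructor forest
  field
    ordered     : Ordered u 0 ts
    occurrences : ∀ i → occF i ts ≡ occ i M

emptyForest : ∀ u → Enumeration (Forest [] u)
emptyForest u = record
  { elements = [ [] ]
  ; unique   = [] ∷ []
  ; sound    = λ { (here refl) → forest [] (λ _ → refl) }
  ; complete = λ { {[]} _ → here refl
                 ; {node j ts ∷ us} (forest _ occ≡) →
                     contradiction (sym (occ≡ j)) (<⇒≢ (subst (0 <_) (cong (_+ occ j (labelsF ts ++ labelsF us)) (sym (δ-refl j))) z<s)) }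
  }

fillForests : ∀ {M t} r → occ t M ≡ 0 → Enumeration (Forest M t) → Enumeration (Forest (M ++ List.replicate r t) (suc t))
fillForests {M} {t} r occ≡0 E = fibred (fill t r r) (prune t) E
  (λ {ts} _ → fill-unique t r r ts)
  (λ {ts} {ts′} (forest o occ≡) ts∈ →
    trans (fill-prune t r r ts ts∈) (prune-id o) ,
    forest (fill-ordered t r r ts∈ z≤n (ordered-suc o))
      (λ i → trans (fill-occ t r r ts ts∈ i) (trans (cong (_+ r * δ i t) (occ≡ i)) (sym (occ-M i)))))
  (λ {ts} (forest o occ≡) →
    let occ-t : occF t ts ≡ r
        occ-t = trans (occ≡ t) (trans (occ-M t) (trans (cong₂ (λ x y → x + r * y) occ≡0 (δ-refl t)) (*-identityʳ r)))
        ts∈ : ts ∈ fill t r r (prune t ts)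
        ts∈ = subst (λ s → ts ∈ fill t r s (prune t ts)) occ-t (fill-complete t r o (≤-reflexive occ-t))
    in forest (prune-ordered o) (λ i → +-cancelʳ-≡ (r * δ i t) _ _
         (trans (sym (fill-occ t r r (prune t ts) ts∈ i)) (trans (occ≡ i) (occ-M i)))) , ts∈)
  where
  occ-M : ∀ i → occ i (M ++ List.replicate r t) ≡ occ i M + r * δ i t
  occ-M i = trans (∑ℕ-++ M (List.replicate r t) (δ i)) (cong (occ i M +_) (occ-replicate i r t))

-- Words of given content

multiplicity : Vec ℕ n → ℕ → ℕ
multiplicity []      _       = 0
multiplicity (m ∷ 𝐦) zero    = m
multiplicity (m ∷ 𝐦) (suc i) = multiplicity 𝐦 i

multiplicity-lookup : ∀ (𝐦 : Vec ℕ n) j → multiplicity 𝐦 (toℕ j) ≡ Vec.lookup 𝐦 j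
multiplicity-lookup (m ∷ 𝐦) Fin.zero    = refl
multiplicity-lookup (m ∷ 𝐦) (Fin.suc j) = multiplicity-lookup 𝐦 j

multiplicity-≥ : ∀ (𝐦 : Vec ℕ n) {i} → n ≤ i → multiplicity 𝐦 i ≡ 0
multiplicity-≥ []      _         = refl
multiplicity-≥ (m ∷ 𝐦) (s≤s n≤i) = multiplicity-≥ 𝐦 n≤i

multiplicity-∷ʳ : ∀ (𝐦 : Vec ℕ n) k i → multiplicity (𝐦 ∷ʳ k) i ≡ multiplicity 𝐦 i + k * δ i n
multiplicity-∷ʳ []      k zero    = sym (*-identityʳ k)
multiplicity-∷ʳ []      k (suc i) = sym (*-zeroʳ k)
multiplicity-∷ʳ (m ∷ 𝐦) k zero    = sym (trans (cong (m +_) (*-zeroʳ k)) (+-identityʳ m))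
multiplicity-∷ʳ (m ∷ 𝐦) k (suc i) = multiplicity-∷ʳ 𝐦 k i

sum-∷ʳ : ∀ (𝐦 : Vec ℕ n) k → Vec.sum (𝐦 ∷ʳ k) ≡ Vec.sum 𝐦 + k
sum-∷ʳ []      k = +-identityʳ k
sum-∷ʳ (m ∷ 𝐦) k = trans (cong (m +_) (sum-∷ʳ 𝐦 k)) (sym (+-assoc m _ k))

Word : Vec ℕ n → List ℕ → Set
Word {n} 𝐦 w = All (_< n) w × length w ≡ Vec.sum 𝐦 × (∀ i → occ i w ≡ multiplicity 𝐦 i)

toWord : Vec (Fin n) l → List ℕ
toWord []      = []
toWord (x ∷ π) = toℕ x ∷ toWord π

toWord-injective : ∀ (π ρ : Vec (Fin n) l) → toWord π ≡ toWord ρ → π ≡ ρ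
toWord-injective []      []      _  = refl
toWord-injective (x ∷ π) (y ∷ ρ) eq = cong₂ _∷_ (toℕ-injective (∷-injectiveˡ eq)) (toWord-injective π ρ (∷-injectiveʳ eq))

length-toWord : ∀ (π : Vec (Fin n) l) → length (toWord π) ≡ l
length-toWord []      = refl
length-toWord (x ∷ π) = cong suc (length-toWord π)

toWord-< : ∀ (π : Vec (Fin n) l) → All (_< n) (toWord π)
toWord-< []      = []
toWord-< (x ∷ π) = toℕ<n x ∷ toWord-< π

occ-toWord : ∀ (j : Fin n) (π : Vec (Fin n) l) → occ (toℕ j) (toWord π) ≡ Vec.count (j Fin.≟_) π
occ-toWord j []      = refl
occ-toWord j (x ∷ π) with j Fin.≟ x
... | yes refl rewrite δ-refl (toℕ j) = cong suc (occ-toWord j π)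
... | no  j≢x  rewrite δ-≢ (j≢x ∘ toℕ-injective) = occ-toWord j π

descents-toWord : ∀ (π : Vec (Fin n) l) → descents (toWord π) ≡ des π
descents-toWord []          = refl
descents-toWord (x ∷ [])    = refl
descents-toWord (x ∷ y ∷ π) = cong ((if does (y Fin.<? x) then 1 else 0) +_) (descents-toWord (y ∷ π))

fromWord : ∀ {w} → All (_< n) w → length w ≡ l → ∃[ π ] toWord {n} {l} π ≡ w
fromWord []          refl = [] , refl
fromWord (x<n ∷ w<n) refl = let π , eq = fromWord w<n refl in
  fromℕ< x<n ∷ π , cong₂ _∷_ (toℕ-fromℕ< x<n) eq

occ-≥ : ∀ {i w} → All (_< n) w → n ≤ i → occ i w ≡ 0
occ-≥ []          n≤i = refl
occ-≥ (x<n ∷ w<n) n≤i = cong₂ _+_ (δ-≢ (>⇒≢ (<-≤-trans x<n n≤i))) (occ-≥ w<n n≤i)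

allWords-unique : ∀ n l → Unique (allWords n l)
allWords-unique n zero    = [] ∷ []
allWords-unique n (suc l) = Unique.cartesianProductWith⁺ _∷_ (λ { refl → refl , refl }) (Unique.allFin⁺ n) (allWords-unique n l)

allWords-complete : ∀ (π : Vec (Fin n) l) → π ∈ allWords n l
allWords-complete []      = here refl
allWords-complete (x ∷ π) = ∈-cartesianProductWith⁺ _∷_ (∈-allFin x) (allWords-complete π)

wordEnumeration : (𝐦 : Vec ℕ n) → Enumeration (Word 𝐦)
wordEnumeration {n} 𝐦 = record
  { elements = map toWord (words 𝐦)
  ; unique   = Unique.map⁺ (toWord-injective _ _) (Unique.filter⁺ (hasContent? 𝐦) (allWords-unique n (Vec.sum 𝐦)))
  ; sound    = λ w∈ → sound′ (∈-map⁻ toWord w∈)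
  ; complete = complete′
  }
  where
  sound′ : ∀ {w} → ∃[ π ] π ∈ words 𝐦 × w ≡ toWord π → Word 𝐦 w
  sound′ (π , π∈ , refl) = toWord-< π , length-toWord π , occ≡
    where
    occ≡ : ∀ i → occ i (toWord π) ≡ multiplicity 𝐦 i
    occ≡ i with i <? n
    ... | no  i≮n = trans (occ-≥ (toWord-< π) (≮⇒≥ i≮n)) (sym (multiplicity-≥ 𝐦 (≮⇒≥ i≮n)))
    ... | yes i<n = begin
      occ i (toWord π)                    ≡⟨ cong (λ i → occ i (toWord π)) (toℕ-fromℕ< i<n) ⟨
      occ (toℕ (fromℕ< i<n)) (toWord π)   ≡⟨ occ-toWord (fromℕ< i<n) π ⟩
      Vec.count (fromℕ< i<n Fin.≟_) π     ≡⟨ proj₂ (∈-filter⁻ (hasContent? 𝐦) {xs = allWords n (Vec.sum 𝐦)} π∈) (fromℕ< i<n) ⟩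
      Vec.lookup 𝐦 (fromℕ< i<n)           ≡⟨ multiplicity-lookup 𝐦 (fromℕ< i<n) ⟨
      multiplicity 𝐦 (toℕ (fromℕ< i<n))   ≡⟨ cong (multiplicity 𝐦) (toℕ-fromℕ< i<n) ⟩
      multiplicity 𝐦 i                    ∎
      where open ≡-Reasoning

  complete′ : ∀ {w} → Word 𝐦 w → w ∈ map toWord (words 𝐦)
  complete′ {w} (w<n , len , occ≡) with π , refl ← fromWord w<n len =
    ∈-map⁺ toWord (∈-filter⁺ (hasContent? 𝐦) (allWords-complete π)
      λ j → trans (sym (occ-toWord j π)) (trans (occ≡ (toℕ j)) (multiplicity-lookup 𝐦 j)))

erase : ℕ → List ℕ → List ℕ
erase t = filter (λ x → ¬? (x ≟ t))

module _ (t : ℕ) where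

  ∈-insertions-top : ∀ k w {v} → v ∈ insertions t k w → t ∷ v ∈ insertions t (suc k) w
  ∈-insertions-top k []      v∈ = ∈-map⁺ (t ∷_) v∈
  ∈-insertions-top k (x ∷ w) v∈ = ∈-++⁺ˡ (∈-map⁺ (t ∷_) v∈)

  ∈-insertions-∷ : ∀ k x w {v} → v ∈ insertions t k w → x ∷ v ∈ insertions t k (x ∷ w)
  ∈-insertions-∷ zero    x w (here refl) = here refl
  ∈-insertions-∷ (suc k) x w v∈          = ∈-++⁺ʳ _ (∈-map⁺ (x ∷_) v∈)

  insertions-complete : ∀ v → v ∈ insertions t (occ t v) (erase t v)
  insertions-complete []      = here refl
  insertions-complete (x ∷ v) with x ≟ t
  ... | yes refl rewrite filter-reject (λ y → ¬? (y ≟ t)) {t} {v} (λ t≢t → t≢t refl) | δ-refl t = ∈-insertions-top (occ t v) (erase t v) (insertions-complete v)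
  ... | no  x≢t  rewrite filter-accept (λ y → ¬? (y ≟ t)) {x} {v} x≢t | δ-≢ (x≢t ∘ sym) = ∈-insertions-∷ (occ t v) x (erase t v) (insertions-complete v)

  data Insertion : ℕ → List ℕ → List ℕ → Set where
    none : ∀ {w} → Insertion 0 w w
    top  : ∀ {k w v} → Insertion k w v → Insertion (suc k) w (t ∷ v)
    keep : ∀ {k x w v} → Insertion k w v → Insertion k (x ∷ w) (x ∷ v)

  insertions-sound : ∀ k w {v} → v ∈ insertions t k w → Insertion k w v
  insertions-sound zero    w       (here refl) = none
  insertions-sound (suc k) []      v∈ with _ , v∈ , refl ← ∈-map⁻ (t ∷_) v∈ = top (insertions-sound k [] v∈)
  insertions-sound (suc k) (x ∷ w) v∈ with ∈-++⁻ (map (t ∷_) (insertions t k (x ∷ w))) v∈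
  ... | inj₁ v∈ with _ , v∈ , refl ← ∈-map⁻ (t ∷_) v∈ = top (insertions-sound k (x ∷ w) v∈)
  ... | inj₂ v∈ with _ , v∈ , refl ← ∈-map⁻ (x ∷_) v∈ = keep (insertions-sound (suc k) w v∈)

  insertion-occ : ∀ {k w v} → Insertion k w v → ∀ i → occ i v ≡ occ i w + k * δ i t
  insertion-occ none                      i = sym (+-identityʳ _)
  insertion-occ (top {k} {w} ins)         i rewrite insertion-occ ins i = x∙yz≈y∙xz (δ i t) (occ i w) (k * δ i t)
  insertion-occ (keep {k} {x} {w} ins)    i rewrite insertion-occ ins i = sym (+-assoc (δ i x) (occ i w) _)

  insertion-length : ∀ {k w v} → Insertion k w v → length v ≡ length w + k
  insertion-length none       = sym (+-identityʳ _)
  insertion-length (top ins)  = trans (cong suc (insertion-length ins)) (sym (+-suc _ _))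
  insertion-length (keep ins) = cong suc (insertion-length ins)

  insertion-< : ∀ {k w v} → Insertion k w v → All (_< suc t) w → All (_< suc t) v
  insertion-< none       w<             = w<
  insertion-< (top ins)  w<             = n<1+n t ∷ insertion-< ins w<
  insertion-< (keep ins) (x< ∷ w<)      = x< ∷ insertion-< ins w<

  insertion-erase : ∀ {k w v} → Insertion k w v → All (_< t) w → erase t v ≡ w
  insertion-erase none                w<        = filter-all _ (All.map <⇒≢ w<)
  insertion-erase (top {v = v} ins)   w<        = trans (filter-reject _ {t} {v} (λ t≢t → t≢t refl)) (insertion-erase ins w<)
  insertion-erase (keep {v = v} ins)  (x< ∷ w<) = trans (filter-accept _ {xs = v} (<⇒≢ x<)) (cong (_ ∷_) (insertion-erase ins w<))

  insertions-unique : ∀ k w → All (_< t) w → Unique (insertions t k w)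
  insertions-unique zero    w       _         = [] ∷ []
  insertions-unique (suc k) []      _         = Unique.map⁺ (λ { refl → refl }) (insertions-unique k [] [])
  insertions-unique (suc k) (x ∷ w) (x< ∷ w<) = Unique.++⁺
    (Unique.map⁺ (λ { refl → refl }) (insertions-unique k (x ∷ w) (x< ∷ w<)))
    (Unique.map⁺ (λ { refl → refl }) (insertions-unique (suc k) w w<))
    λ (v∈ , v∈′) → disjoint (∈-map⁻ (t ∷_) v∈) (∈-map⁻ (x ∷_) v∈′)
    where
    disjoint : ∀ {v} → ∃[ u ] u ∈ insertions t k (x ∷ w) × v ≡ t ∷ u → ∃[ u ] u ∈ insertions t (suc k) w × v ≡ x ∷ u → _
    disjoint (_ , _ , refl) (_ , _ , refl) = n≮n t x<

  all-erase : ∀ {v} → All (_< suc t) v → All (_< t) (erase t v)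
  all-erase {v} v< = All.zipWith (λ (x< , x≢t) → ≤∧≢⇒< (≤-pred x<) x≢t) (filter⁺ _ v< , all-filter _ v)

insertTop : ∀ {𝐦 : Vec ℕ n} k → Enumeration (Word 𝐦) → Enumeration (Word (𝐦 ∷ʳ k))
insertTop {n} {𝐦} k E = fibred (insertions n k) (erase n) E
  (λ {w} (w< , _) → insertions-unique n k w w<)
  (λ {w} (w< , len , occ≡) v∈ → let ins = insertions-sound n k w v∈ in
    insertion-erase n ins w< ,
    insertion-< n ins (All.map m<n⇒m<1+n w<) ,
    trans (insertion-length n ins) (trans (cong (_+ k) len) (sym (sum-∷ʳ 𝐦 k))) ,
    λ i → trans (insertion-occ n ins i) (trans (cong (_+ k * δ i n) (occ≡ i)) (sym (multiplicity-∷ʳ 𝐦 k i))))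
  (λ {v} (v< , len , occ≡) →
    let occ-n : occ n v ≡ k
        occ-n = trans (occ≡ n) (trans (multiplicity-∷ʳ 𝐦 k n)
                  (trans (cong₂ (λ x y → x + k * y) (multiplicity-≥ 𝐦 ≤-refl) (δ-refl n)) (*-identityʳ k)))
        v∈ : v ∈ insertions n k (erase n v)
        v∈ = subst (λ j → v ∈ insertions n j (erase n v)) occ-n (insertions-complete n v)
        ins = insertions-sound n k (erase n v) v∈
    in (all-erase n v< ,
        +-cancelʳ-≡ k _ _ (trans (sym (insertion-length n ins)) (trans len (sum-∷ʳ 𝐦 k))) ,
        λ i → +-cancelʳ-≡ (k * δ i n) _ _ (trans (sym (insertion-occ n ins i)) (trans (occ≡ i) (multiplicity-∷ʳ 𝐦 k i)))) ,
       v∈)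

-- Deleting the largest letter fibres the longer words over the shorter ones, and by `insertions-δ`
-- the contribution of a fibre depends only on the descents of the word below it.
words-∷ʳ : ∀ (𝐦 : Vec ℕ n) k q →
    ∑ℕ (words (𝐦 ∷ʳ k)) (λ π → δ q (des π))
  ≡ ∑ℕ (words 𝐦) (λ π → choose (Vec.sum 𝐦 ∸ des π) q (des π) * choose (k + des π) q 0)
words-∷ʳ {n} 𝐦 k q = begin
  ∑ℕ (words (𝐦 ∷ʳ k)) (λ π → δ q (des π))
    ≡⟨ ∑ℕ-cong (words (𝐦 ∷ʳ k)) (λ π → cong (δ q) (sym (descents-toWord π))) ⟩
  ∑ℕ (words (𝐦 ∷ʳ k)) (δ q ∘ descents ∘ toWord)
    ≡⟨ ∑ℕ-map toWord (words (𝐦 ∷ʳ k)) (δ q ∘ descents) ⟨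
  ∑ℕ (wordEnumeration (𝐦 ∷ʳ k) .elements) (δ q ∘ descents)
    ≡⟨ ∑ℕ-↭ (δ q ∘ descents) (elements-↭ (wordEnumeration (𝐦 ∷ʳ k)) (insertTop {𝐦 = 𝐦} k (wordEnumeration 𝐦)) (λ w → w) (λ w → w)) ⟩
  ∑ℕ (insertTop {𝐦 = 𝐦} k (wordEnumeration 𝐦) .elements) (δ q ∘ descents)
    ≡⟨ ∑ℕ-concatMap (insertions n k) (map toWord (words 𝐦)) (δ q ∘ descents) ⟩
  ∑ℕ (map toWord (words 𝐦)) (λ w → ∑ℕ (insertions n k w) (δ q ∘ descents))
    ≡⟨ ∑ℕ-map toWord (words 𝐦) _ ⟩
  ∑ℕ (words 𝐦) (λ π → ∑ℕ (insertions n k (toWord π)) (δ q ∘ descents))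
    ≡⟨ ∑ℕ-cong (words 𝐦) (λ π → trans (insertions-δ n q k (toWord π) (toWord-< π))
         (cong₂ (λ m e → choose (m ∸ e) q e * choose (k + e) q 0) (length-toWord π) (descents-toWord π))) ⟩
  ∑ℕ (words 𝐦) (λ π → choose (Vec.sum 𝐦 ∸ des π) q (des π) * choose (k + des π) q 0)
    ∎
  where open ≡-Reasoning

replicate-∷ʳ : ∀ n (k : ℕ) → replicate n k ∷ʳ k ≡ replicate (suc n) k
replicate-∷ʳ zero    k = refl
replicate-∷ʳ (suc n) k = cong (k ∷_) (replicate-∷ʳ n k)

sum-replicate : ∀ n k → Vec.sum (replicate n k) ≡ n * k
sum-replicate zero    k = refl
sum-replicate (suc n) k = cong (k +_) (sum-replicate n k)

-- Descents and leaves

blocks : ℕ → ℕ → List ℕ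
blocks k N = concat (map (λ j → List.replicate k (suc j)) (upTo N))

blocks-suc : ∀ k N → blocks k (suc N) ≡ blocks k N ++ List.replicate k (suc N)
blocks-suc k N = begin
  blocks k (suc N)                                          ≡⟨ cong (concat ∘ map f) (upTo-∷ʳ N) ⟨
  concat (map f (upTo N ++ [ N ]))                          ≡⟨ cong concat (map-++ f (upTo N) [ N ]) ⟩
  concat (map f (upTo N) ++ [ f N ])                        ≡⟨ concat-++ (map f (upTo N)) [ f N ] ⟨
  blocks k N ++ concat [ f N ]                              ≡⟨ cong (blocks k N ++_) (++-identityʳ (f N)) ⟩
  blocks k N ++ f N                                         ∎
  where
  open ≡-Reasoning
  f : ℕ → List ℕ
  f j = List.replicate k (suc j)

occ-blocks-> : ∀ k N {i} → N < i → occ i (blocks k N) ≡ 0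
occ-blocks-> k zero    N<i = refl
occ-blocks-> k (suc N) {i} N<i
  rewrite blocks-suc k N | ∑ℕ-++ (blocks k N) (List.replicate k (suc N)) (δ i)
        | occ-blocks-> k N (<-trans (n<1+n N) N<i) | occ-replicate i k (suc N) | δ-≢ (>⇒≢ N<i) = *-zeroʳ k

length-blocks : ∀ k N → length (blocks k N) ≡ N * k
length-blocks k zero    = refl
length-blocks k (suc N)
  rewrite blocks-suc k N | length-++ (blocks k N) {List.replicate k (suc N)} | length-blocks k N | length-replicate k {suc N} = +-comm (N * k) k

blockForests : ∀ k N → Enumeration (Forest (blocks k N) (suc N))
blockForests k zero    = emptyForest 1
blockForests k (suc N) =
  transfer (λ {T} → subst (λ M → Forest M (suc (suc N)) T) (sym (blocks-suc k N)))
           (λ {T} → subst (λ M → Forest M (suc (suc N)) T) (blocks-suc k N))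
           (fillForests k (occ-blocks-> k N (n<1+n N)) (blockForests k N))

blockForests₁ : ∀ k N → Enumeration (Forest (blocks k N ++ [ suc N ]) (suc (suc N)))
blockForests₁ k N = fillForests 1 (occ-blocks-> k N (n<1+n N)) (blockForests k N)

occ-blocks₁-> : ∀ k N → occ (suc (suc N)) (blocks k N ++ [ suc N ]) ≡ 0
occ-blocks₁-> k N rewrite ∑ℕ-++ (blocks k N) [ suc N ] (δ (suc (suc N))) | occ-blocks-> k N (<-trans (n<1+n N) (n<1+n (suc N)))
    | δ-≢ (>⇒≢ (n<1+n N)) = refl

blockForests₂ : ∀ k N → Enumeration (Forest ((blocks k N ++ [ suc N ]) ++ [ suc (suc N) ]) (suc (suc (suc N))))
blockForests₂ k N = fillForests 1 (occ-blocks₁-> k N) (blockForests₁ k N)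

forest-slots : ∀ {M u ts} → Forest M u ts → leavesF ts + rightSlots ts ≡ suc (length M)
forest-slots {M} {ts = ts} (forest _ occ≡) = trans (slots ts) (cong suc (↭-length (occ-≡⇒↭ (labelsF ts) M occ≡)))

∑slots : List (List Tree) → (ℕ → ℕ → ℕ) → ℕ
∑slots Ts h = ∑ℕ Ts (λ ts → h (leavesF ts) (rightSlots ts))

∑slots-fill : ∀ {M t} r (occ≡0 : occ t M ≡ 0) (E : Enumeration (Forest M t)) h →
              ∑slots (fillForests r occ≡0 E .elements) h ≡ ∑slots (E .elements) (λ x y → place r x y h)
∑slots-fill {t = t} r occ≡0 E h = trans (∑ℕ-concatMap (fill t r r) (E .elements) _)
  (∑ℕ-cong (E .elements) (λ ts → ∑-fill t r r ts h ≤-refl))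

-- After a node has been placed some left slot is free, so values at zero leaves carry no weight.
-- This makes `pred` harmless in the translation from leaves to descents.
place-one-cong : ∀ ℓ r {h h′ : ℕ → ℕ → ℕ} →
                 (∀ x y → suc x + y ≡ suc (ℓ + r) → h (suc x) y ≡ h′ (suc x) y) → place 1 ℓ r h ≡ place 1 ℓ r h′
place-one-cong ℓ r {h} {h′} eq = begin
  place 1 ℓ r h                            ≡⟨ place-one ℓ r h ⟩
  ℓ * h ℓ (suc r) + r * h (suc ℓ) r        ≡⟨ cong₂ _+_ (left ℓ eq) (cong (r *_) (eq ℓ r refl)) ⟩
  ℓ * h′ ℓ (suc r) + r * h′ (suc ℓ) r      ≡⟨ place-one ℓ r h′ ⟨
  place 1 ℓ r h′                           ∎
  where
  open ≡-Reasoning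
  left : ∀ ℓ → (∀ x y → suc x + y ≡ suc (ℓ + r) → h (suc x) y ≡ h′ (suc x) y) → ℓ * h ℓ (suc r) ≡ ℓ * h′ ℓ (suc r)
  left zero    eq = refl
  left (suc ℓ) eq = cong (suc ℓ *_) (eq ℓ (suc r) (cong suc (+-suc ℓ r)))

Mirrored : List (List Tree) → Set
Mirrored Ts = ∀ (h : ℕ → ℕ → ℕ) → ∑slots Ts h ≡ ∑slots Ts (flip h)

mirrored-fill : ∀ {M t} r (occ≡0 : occ t M ≡ 0) (E : Enumeration (Forest M t)) →
                Mirrored (E .elements) → Mirrored (fillForests r occ≡0 E .elements)
mirrored-fill r occ≡0 E mir h = begin
  ∑slots (fillForests r occ≡0 E .elements) h            ≡⟨ ∑slots-fill r occ≡0 E h ⟩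
  ∑slots (E .elements) (λ x y → place r x y h)          ≡⟨ mir (λ x y → place r x y h) ⟩
  ∑slots (E .elements) (λ x y → place r y x h)          ≡⟨ ∑ℕ-cong (E .elements) (λ ts → place-mirror r (rightSlots ts) (leavesF ts) h) ⟩
  ∑slots (E .elements) (λ x y → place r x y (flip h))   ≡⟨ ∑slots-fill r occ≡0 E (flip h) ⟨
  ∑slots (fillForests r occ≡0 E .elements) (flip h)     ∎
  where open ≡-Reasoning

-- For `m` = N k, the left side is the number of weak rises, the start included, of a word on N + 1
-- blocks with `e` descents, and `y` is the number of right slots of a matching tree. The excess
-- `k′` is the source of the factor k - 1.
rises-count : ∀ k′ m e y → e + y ≡ suc m → suc k′ + m ∸ e ≡ y + k′
rises-count k′ m e y eq = begin
  suc k′ + m ∸ e     ≡⟨ cong (_∸ e) (+-suc k′ m) ⟨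
  k′ + suc m ∸ e     ≡⟨ cong (λ j → k′ + j ∸ e) eq ⟨
  k′ + (e + y) ∸ e   ≡⟨ cong (_∸ e) (x∙yz≈y∙zx k′ e y) ⟩
  e + (y + k′) ∸ e   ≡⟨ m+n∸m≡n e (y + k′) ⟩
  y + k′             ∎
  where open ≡-Reasoning

module _ (k′ : ℕ) where

  private
    k = suc k′

  DescentsAreLeaves : ℕ → Set
  DescentsAreLeaves N = ∀ (h : ℕ → ℕ) →
    ∑ℕ (words (replicate (suc N) k)) (λ π → h (suc (des π))) ≡ ∑slots (blockForests₁ k N .elements) (λ x _ → h x)

  -- Equal counts for each value make the two lists of values permutations of each other, so every
  -- test function has the same sum. The value 0 never occurs: descents are shifted by one, and each
  -- of these forests has a leaf.
  fromδ : ∀ N → (∀ s → ∑ℕ (words (replicate (suc N) k)) (λ π → δ s (des π))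
                     ≡ ∑slots (blockForests₁ k N .elements) (λ x _ → δ (suc s) x)) → DescentsAreLeaves N
  fromδ N eq h = begin
    ∑ℕ ws (λ π → h (suc (des π)))        ≡⟨ ∑ℕ-map (suc ∘ des) ws h ⟨
    ∑ℕ (map (suc ∘ des) ws) h            ≡⟨ ∑ℕ-↭ h (occ-≡⇒↭ (map (suc ∘ des) ws) (map leavesF Ts) occ≡) ⟩
    ∑ℕ (map leavesF Ts) h                ≡⟨ ∑ℕ-map leavesF Ts h ⟩
    ∑slots Ts (λ x _ → h x)              ∎
    where
    open ≡-Reasoning
    ws = words (replicate (suc N) k)
    Ts = blockForests₁ k N .elements
    occ≡ : ∀ i → occ i (map (suc ∘ des) ws) ≡ occ i (map leavesF Ts)
    occ≡ i = trans (∑ℕ-map (suc ∘ des) ws (δ i)) (trans (δ≡ i) (sym (∑ℕ-map leavesF Ts (δ i))))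
      where
      δ≡ : ∀ i → ∑ℕ ws (λ π → δ i (suc (des π))) ≡ ∑slots Ts (λ x _ → δ i x)
      δ≡ (suc s) = eq s
      δ≡ zero    = trans (∑ℕ-0 ws) (sym (trans (∑slots-fill 1 (occ-blocks-> k N (n<1+n N)) (blockForests k N) (λ x _ → δ 0 x))
        (trans (∑ℕ-cong (blockForests k N .elements) (λ ts → place-one-cong (leavesF ts) (rightSlots ts) {h′ = λ _ _ → 0} (λ _ _ _ → refl)))
          (trans (∑ℕ-cong (blockForests k N .elements) (λ ts → place-0 (leavesF ts) (rightSlots ts))) (∑ℕ-0 (blockForests k N .elements))))))
        where
        place-0 : ∀ ℓ r → place 1 ℓ r (λ _ _ → 0) ≡ 0
        place-0 ℓ r = trans (place-one ℓ r (λ _ _ → 0)) (cong₂ _+_ (*-zeroʳ ℓ) (*-zeroʳ r))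

  -- By induction, with the insertion count of words as test function. Splitting off the top nodes
  -- on the tree side turns both sides into sums over the same forests on N full blocks, where
  -- `place-swap` applies to each summand.
  descents-are-leaves : ∀ N → DescentsAreLeaves N
  descents-are-leaves zero = fromδ 0 λ s → trans (words-∷ʳ [] k s) (cong (_+ 0) (point s))
    where
    point : ∀ s → choose 0 s 0 * choose (k + 0) s 0 ≡ δ s 0
    point zero    = trans (+-identityʳ _) (choose-bottom (k + 0) 0)
    point (suc s) = refl
  descents-are-leaves (suc N) = fromδ (suc N) λ s → begin
    ∑ℕ (words (replicate (suc (suc N)) k)) (λ π → δ s (des π))
      ≡⟨ cong (λ 𝐦 → ∑ℕ (words 𝐦) (λ π → δ s (des π))) (replicate-∷ʳ (suc N) k) ⟨
    ∑ℕ (words (replicate (suc N) k ∷ʳ k)) (λ π → δ s (des π))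
      ≡⟨ words-∷ʳ (replicate (suc N) k) k s ⟩
    ∑ℕ (words (replicate (suc N) k)) (λ π → choose (Vec.sum (replicate (suc N) k) ∸ des π) s (des π) * choose (k + des π) s 0)
      ≡⟨ cong (λ m → ∑ℕ (words (replicate (suc N) k)) (λ π → choose (m ∸ des π) s (des π) * choose (k + des π) s 0)) (sum-replicate (suc N) k) ⟩
    ∑ℕ (words (replicate (suc N) k)) (λ π → inserted s (des π))
      -- The hypothesis speaks of `suc (des π)`; `pred` removes this shift.
      ≡⟨ descents-are-leaves N (inserted s ∘ pred) ⟩
    ∑slots (blockForests₁ k N .elements) (λ x _ → inserted s (pred x))
      ≡⟨ ∑slots-fill 1 (occ-blocks-> k N (n<1+n N)) (blockForests k N) (λ x _ → inserted s (pred x)) ⟩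
    ∑slots (blockForests k N .elements) (λ ℓ r → place 1 ℓ r (λ x _ → inserted s (pred x)))
      ≡⟨ ∑ℕ-cong-∈ (blockForests k N .elements) (λ {ts} ts∈ →
           trans (place-one-cong (leavesF ts) (rightSlots ts) (λ x y eq → swap s x y
                   (trans (suc-injective eq) (trans (forest-slots (blockForests k N .sound ts∈)) (cong suc (length-blocks k N))))))
                 (sym (place-swap k′ (leavesF ts) (rightSlots ts) (suc s)))) ⟩
    ∑slots (blockForests k N .elements) (λ ℓ r → place k ℓ r (λ x y → place 1 x y (λ x′ _ → δ (suc s) x′)))
      ≡⟨ ∑slots-fill k (occ-blocks-> k N (n<1+n N)) (blockForests k N) (λ x y → place 1 x y (λ x′ _ → δ (suc s) x′)) ⟨
    ∑slots (blockForests k (suc N) .elements) (λ x y → place 1 x y (λ x′ _ → δ (suc s) x′))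
      ≡⟨ ∑slots-fill 1 (occ-blocks-> k (suc N) (n<1+n (suc N))) (blockForests k (suc N)) (λ x _ → δ (suc s) x) ⟨
    ∑slots (blockForests₁ k (suc N) .elements) (λ x _ → δ (suc s) x)
      ∎
    where
    open ≡-Reasoning
    inserted : ℕ → ℕ → ℕ
    inserted s e = choose (suc N * k ∸ e) s e * choose (k + e) s 0

    swap : ∀ s x y → x + y ≡ suc (N * k) → inserted s x ≡ choose (suc x + k′) (suc s) 1 * choose (y + k′) (suc s) (suc x)
    swap s x y eq = begin
      choose (suc N * k ∸ x) s x * choose (k + x) s 0
        ≡⟨ cong₂ (λ c c′ → choose c s x * choose c′ s 0) (rises-count k′ (N * k) x y eq) (cong suc (+-comm k′ x)) ⟩
      choose (y + k′) s x * choose (suc x + k′) s 0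
        ≡⟨ *-comm (choose (y + k′) s x) _ ⟩
      choose (suc x + k′) s 0 * choose (y + k′) s x
        ≡⟨ cong₂ _*_ (choose-shift (suc x + k′) s 0) (choose-shift (y + k′) s x) ⟨
      choose (suc x + k′) (suc s) 1 * choose (y + k′) (suc s) (suc x)
        ∎

  -- The empty forest has a single right slot and no left one, so it is not mirrored. The first node
  -- takes that slot and leaves one of each kind, whence the start at one block and at
  -- `place k′ 1 1`.
  mirrored-blocks : ∀ N → Mirrored (blockForests k (suc N) .elements)
  mirrored-blocks zero    h = begin
    ∑slots (blockForests k 1 .elements) h         ≡⟨ ∑slots-fill k refl (emptyForest 1) h ⟩
    place k′ 1 1 h + 0                            ≡⟨ cong (_+ 0) (place-mirror k′ 1 1 h) ⟩
    place k′ 1 1 (flip h) + 0                     ≡⟨ ∑slots-fill k refl (emptyForest 1) (flip h) ⟨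
    ∑slots (blockForests k 1 .elements) (flip h)  ∎
    where open ≡-Reasoning
  mirrored-blocks (suc N) = mirrored-fill k (occ-blocks-> k (suc N) (n<1+n (suc N))) (blockForests k (suc N)) (mirrored-blocks N)

  mirrored-blocks₁ : ∀ N → Mirrored (blockForests₁ k N .elements)
  mirrored-blocks₁ zero    h = refl
  mirrored-blocks₁ (suc N) = mirrored-fill 1 (occ-blocks-> k (suc N) (n<1+n (suc N))) (blockForests k (suc N)) (mirrored-blocks N)

  mirrored-blocks₂ : ∀ N → Mirrored (blockForests₂ k N .elements)
  mirrored-blocks₂ N = mirrored-fill 1 (occ-blocks₁-> k N) (blockForests₁ k N) (mirrored-blocks₁ N)

-- Weakly increasing trees as ordered forests

-- The two order conditions sit on the two kinds of edges of the binary tree: a left edge compares a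
-- node with its parent, a right edge with its left neighbour among the siblings.
increasing⇒ordered : ∀ {u l} ts → All (λ t → l ≤ label t) ts → Linked _≤_ (map label ts) → All Increasing ts →
                     All (_< u) (labelsF ts) → Ordered u l ts
increasing⇒ordered []               _            _      _                  _           = []
increasing⇒ordered (node j ts ∷ us) (l≤j ∷ _) linked (inc j≤ lts its ∷ ius) (j<u ∷ <u)
  with ts<u , us<u ← ++⁻ (labelsF ts) <u =
  node l≤j j<u (increasing⇒ordered ts j≤ lts its ts<u) (increasing⇒ordered us (above us linked) (tail us linked) ius us<u)
  where
  above : ∀ us → Linked _≤_ (j ∷ map label us) → All (λ t → j ≤ label t) us
  above []       _            = []
  above (u ∷ us) (j≤ ∷ linked) = map⁻ (Linked⇒All ≤-trans j≤ linked)
  tail : ∀ us → Linked _≤_ (j ∷ map label us) → Linked _≤_ (map label us)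
  tail []       _            = []
  tail (u ∷ us) (_ ∷ linked) = linked

ordered⇒increasing : ∀ {u l ts} → Ordered u l ts →
                     All (λ t → l ≤ label t) ts × Linked _≤_ (map label ts) × All Increasing ts
ordered⇒increasing []                               = [] , [] , []
ordered⇒increasing (node {j = j} l≤j j<u o o′)
  with j≤ts , lts , its ← ordered⇒increasing o | j≤us , lus , ius ← ordered⇒increasing o′ =
  l≤j ∷ All.map (≤-trans l≤j) j≤us , link j≤us lus , inc j≤ts lts its ∷ ius
  where
  link : ∀ {us} → All (λ t → j ≤ label t) us → Linked _≤_ (map label us) → Linked _≤_ (j ∷ map label us)
  link []       _   = [-]
  link (j≤ ∷ _) lus = j≤ ∷ lus

rooted : ∀ {M u q} {Q : Tree → Set q} → All (_< u) M → Enumeration (λ ts → Forest M u ts × Q (node 0 ts)) →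
         Enumeration (λ t → WeaklyIncreasingTree M t × Q t)
rooted {M} {u} {Q = Q} M<u E = record
  { elements = map (node 0) (E .elements)
  ; unique   = Unique.map⁺ (λ { refl → refl }) (E .unique)
  ; sound    = λ t∈ → sound′ (∈-map⁻ (node 0) t∈)
  ; complete = complete′
  }
  where
  sound′ : ∀ {t} → ∃[ ts ] ts ∈ E .elements × t ≡ node 0 ts → WeaklyIncreasingTree M t × Q t
  sound′ (ts , ts∈ , refl) with forest o occ≡ , q ← E .sound ts∈ | 0≤ , linked , is ← ordered⇒increasing (Forest.ordered (proj₁ (E .sound ts∈))) =
    wit (prep 0 (occ-≡⇒↭ (labelsF ts) M occ≡)) refl (inc 0≤ linked is) , q
  complete′ : ∀ {t} → WeaklyIncreasingTree M t × Q t → t ∈ map (node 0) (E .elements)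
  complete′ {node .0 ts} (wit p refl (inc 0≤ linked is) , q) = ∈-map⁺ (node 0) (E .complete
    (forest (increasing⇒ordered ts 0≤ linked is (All-resp-↭ (↭-sym (drop-∷ p)) M<u))
            (λ i → ∑ℕ-↭ (δ i) (drop-∷ p)) , q))

-- The γ-expansion

-- orbit ts lists the forests obtained from a forest ts without young leaves by turning left subtrees
-- into right ones at nodes without right subtree; toLeft undoes this.

orbit : List Tree → List (List Tree)
orbit []                          = [ [] ]
orbit (node j []       ∷ us)      = map (graft j []) (orbit us)
orbit (node j (t ∷ ts) ∷ [])      = map (λ vs → graft j vs []) (orbit (t ∷ ts)) ++ map (graft j []) (orbit (t ∷ ts))
orbit (node j (t ∷ ts) ∷ u ∷ us)  = cartesianProductWith (graft j) (orbit (t ∷ ts)) (orbit (u ∷ us))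

toLeft : List Tree → List Tree
toLeft []                     = []
toLeft (node j []       ∷ us) = node j (toLeft us) ∷ []
toLeft (node j (t ∷ ts) ∷ us) = node j (toLeft (t ∷ ts)) ∷ toLeft us

data Turned : List Tree → List Tree → Set where
  []   : Turned [] []
  keep : ∀ {j ts ts′ us us′} → Turned ts ts′ → Turned us us′ → Turned (node j ts ∷ us) (node j ts′ ∷ us′)
  turn : ∀ {j ts ts′} → Turned ts ts′ → Turned (node j ts ∷ []) (node j [] ∷ ts′)

orbit-sound : ∀ ts {vs} → vs ∈ orbit ts → Turned ts vs
orbit-sound []                         (here refl) = []
orbit-sound (node j []       ∷ us)     vs∈ with _ , us∈ , refl ← ∈-map⁻ (graft j []) vs∈ = keep [] (orbit-sound us us∈)
orbit-sound (node j (t ∷ ts) ∷ [])     vs∈ with ∈-++⁻ (map (λ vs → graft j vs []) (orbit (t ∷ ts))) vs∈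
... | inj₁ vs∈ with _ , ts∈ , refl ← ∈-map⁻ (λ vs → graft j vs []) vs∈ = keep (orbit-sound (t ∷ ts) ts∈) []
... | inj₂ vs∈ with _ , ts∈ , refl ← ∈-map⁻ (graft j []) vs∈ = turn (orbit-sound (t ∷ ts) ts∈)
orbit-sound (node j (t ∷ ts) ∷ u ∷ us) vs∈
  with _ , _ , ts∈ , us∈ , refl ← ∈-cartesianProductWith⁻ (graft j) (orbit (t ∷ ts)) (orbit (u ∷ us)) vs∈ =
  keep (orbit-sound (t ∷ ts) ts∈) (orbit-sound (u ∷ us) us∈)

turned-occ : ∀ {ts vs} → Turned ts vs → ∀ i → occF i vs ≡ occF i ts
turned-occ []                                         i = refl
turned-occ (keep {j} {ts} {ts′} {us} {us′} p q) i
  rewrite occF-node i j ts us | occF-node i j ts′ us′ = cong (δ i j +_) (cong₂ _+_ (turned-occ p i) (turned-occ q i))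
turned-occ (turn {j} {ts} {ts′} p)              i
  rewrite occF-node i j ts [] = cong (δ i j +_) (trans (turned-occ p i) (sym (+-identityʳ _)))

turned-ordered : ∀ {u l ts vs} → Turned ts vs → Ordered u l ts → Ordered u l vs
turned-ordered []         []                  = []
turned-ordered (keep p q) (node l≤j j<u o o′) = node l≤j j<u (turned-ordered p o) (turned-ordered q o′)
turned-ordered (turn p)   (node l≤j j<u o o′) = node l≤j j<u [] (turned-ordered p o)

turned-ordered⁻ : ∀ {u l ts vs} → Turned ts vs → Ordered u l vs → Ordered u l ts
turned-ordered⁻ []         []                  = []
turned-ordered⁻ (keep p q) (node l≤j j<u o o′) = node l≤j j<u (turned-ordered⁻ p o) (turned-ordered⁻ q o′)
turned-ordered⁻ (turn p)   (node l≤j j<u o o′) = node l≤j j<u (turned-ordered⁻ p o′) []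

[]∉orbit : ∀ t ts → [] ∉ orbit (t ∷ ts)
[]∉orbit t ts []∈ with orbit-sound (t ∷ ts) []∈
... | ()

orbit-unique : ∀ ts → Unique (orbit ts)
orbit-unique []                         = [] ∷ []
orbit-unique (node j []       ∷ us)     = Unique.map⁺ (λ { refl → refl }) (orbit-unique us)
orbit-unique (node j (t ∷ ts) ∷ [])     = Unique.++⁺
  (Unique.map⁺ (λ { refl → refl }) (orbit-unique (t ∷ ts))) (Unique.map⁺ (λ { refl → refl }) (orbit-unique (t ∷ ts)))
  λ (vs∈ , vs∈′) → disjoint (∈-map⁻ (λ vs → graft j vs []) vs∈) (∈-map⁻ (graft j []) vs∈′)
  where
  disjoint : ∀ {vs} → ∃[ ts′ ] ts′ ∈ orbit (t ∷ ts) × vs ≡ graft j ts′ [] → ∃[ ts′ ] ts′ ∈ orbit (t ∷ ts) × vs ≡ graft j [] ts′ → _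
  disjoint (_ , []∈ , refl) (_ , _ , refl) = []∉orbit t ts []∈
orbit-unique (node j (t ∷ ts) ∷ u ∷ us) =
  Unique.cartesianProductWith⁺ (graft j) (λ { refl → refl , refl }) (orbit-unique (t ∷ ts)) (orbit-unique (u ∷ us))

∈-orbit-keep : ∀ j t ts us {ts′ us′} → ts′ ∈ orbit (t ∷ ts) → us′ ∈ orbit us → node j ts′ ∷ us′ ∈ orbit (node j (t ∷ ts) ∷ us)
∈-orbit-keep j t ts []       ts∈ (here refl) = ∈-++⁺ˡ (∈-map⁺ (λ vs → graft j vs []) ts∈)
∈-orbit-keep j t ts (u ∷ us) ts∈ us∈         = ∈-cartesianProductWith⁺ (graft j) ts∈ us∈

∈-orbit-turn : ∀ j ts {ts′} → ts′ ∈ orbit ts → node j [] ∷ ts′ ∈ orbit (node j ts ∷ [])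
∈-orbit-turn j []       (here refl) = here refl
∈-orbit-turn j (t ∷ ts) ts∈         = ∈-++⁺ʳ (map (λ vs → graft j vs []) (orbit (t ∷ ts))) (∈-map⁺ (graft j []) ts∈)

toLeft-∷ : ∀ t ts → ∃₂ λ u us → toLeft (t ∷ ts) ≡ u ∷ us
toLeft-∷ (node j [])       us = _ , _ , refl
toLeft-∷ (node j (t ∷ ts)) us = _ , _ , refl

∈-orbit-toLeft : ∀ vs → vs ∈ orbit (toLeft vs)
∈-orbit-toLeft []                     = here refl
∈-orbit-toLeft (node j []       ∷ us) = ∈-orbit-turn j (toLeft us) (∈-orbit-toLeft us)
∈-orbit-toLeft (node j (t ∷ ts) ∷ us) with u , us′ , eq ← toLeft-∷ t ts | ih ← ∈-orbit-toLeft (t ∷ ts)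
  rewrite eq = ∈-orbit-keep j u us′ (toLeft us) ih (∈-orbit-toLeft us)

young-∷ : ∀ j t ts us → youngLeavesF (node j (t ∷ ts) ∷ us) ≡ youngLeavesF (t ∷ ts) + youngLeavesF us
young-∷ j t ts []       = sym (+-identityʳ _)
young-∷ j t ts (u ∷ us) = refl

young-toLeft : ∀ vs → youngLeavesF (toLeft vs) ≡ 0
young-toLeft []                     = refl
young-toLeft (node j []       ∷ us) = young-toLeft us
young-toLeft (node j (t ∷ ts) ∷ us) with u , us′ , eq ← toLeft-∷ t ts | ih ← young-toLeft (t ∷ ts)
  rewrite eq | young-∷ j u us′ (toLeft us) | ih = young-toLeft us

-- Without young leaves no node of `ts` has only a right subtree, so the nodes of this kind in `vs`
-- are exactly the turned ones.
toLeft-orbit : ∀ ts {vs} → youngLeavesF ts ≡ 0 → vs ∈ orbit ts → toLeft vs ≡ ts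
toLeft-orbit []                         _ (here refl) = refl
toLeft-orbit (node j []       ∷ [])     _ (here refl) = refl
toLeft-orbit (node j (t ∷ ts) ∷ [])     y vs∈ with ∈-++⁻ (map (λ vs → graft j vs []) (orbit (t ∷ ts))) vs∈
... | inj₂ vs∈ with _ , ts∈ , refl ← ∈-map⁻ (graft j []) vs∈ = cong (λ vs → graft j vs []) (toLeft-orbit (t ∷ ts) y ts∈)
... | inj₁ vs∈ with ∈-map⁻ (λ vs → graft j vs []) vs∈
...   | []     , ts∈ , refl = contradiction ts∈ ([]∉orbit t ts)
...   | _ ∷ _  , ts∈ , refl = cong (λ vs → graft j vs []) (toLeft-orbit (t ∷ ts) y ts∈)
toLeft-orbit (node j (t ∷ ts) ∷ u ∷ us) y vs∈
  with ∈-cartesianProductWith⁻ (graft j) (orbit (t ∷ ts)) (orbit (u ∷ us)) vs∈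
... | []    , _ , ts∈ , us∈ , refl = contradiction ts∈ ([]∉orbit t ts)
... | _ ∷ _ , _ , ts∈ , us∈ , refl = cong₂ (graft j)
  (toLeft-orbit (t ∷ ts) (m+n≡0⇒m≡0 _ y) ts∈) (toLeft-orbit (u ∷ us) (m+n≡0⇒n≡0 (youngLeavesF (t ∷ ts)) y) us∈)

-- The nodes with a left but no right subtree: those that may be turned, and so the exponent of 1 +
-- x.
loneLefts : List Tree → ℕ
loneLefts []                         = 0
loneLefts (node j []       ∷ us)     = loneLefts us
loneLefts (node j (t ∷ ts) ∷ [])     = suc (loneLefts (t ∷ ts))
loneLefts (node j (t ∷ ts) ∷ u ∷ us) = loneLefts (t ∷ ts) + loneLefts (u ∷ us)

-- If no node has only a right subtree, the leaves are the nodes without any subtree, one more than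
-- the nodes with two. All other nodes are lone lefts.
loneLefts-leavesF : ∀ t ts → youngLeavesF (t ∷ ts) ≡ 0 → loneLefts (t ∷ ts) + 2 * leavesF (t ∷ ts) ≡ suc (length (labelsF (t ∷ ts)))
loneLefts-leavesF (node j [])       []       _ = refl
loneLefts-leavesF (node j (t ∷ ts)) []       y
  rewrite +-identityʳ (leavesF (t ∷ ts)) | length-++ (labelsF (t ∷ ts)) {[]} | +-identityʳ (length (labelsF (t ∷ ts))) = cong suc (loneLefts-leavesF t ts y)
loneLefts-leavesF (node j (t ∷ ts)) (u ∷ us) y
  rewrite length-++ (labelsF (t ∷ ts)) {labelsF (u ∷ us)} = begin
  (loneLefts (t ∷ ts) + loneLefts (u ∷ us)) + 2 * (leavesF (t ∷ ts) + leavesF (u ∷ us))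
    ≡⟨ regroup (loneLefts (t ∷ ts)) (loneLefts (u ∷ us)) (leavesF (t ∷ ts)) (leavesF (u ∷ us)) ⟩
  (loneLefts (t ∷ ts) + 2 * leavesF (t ∷ ts)) + (loneLefts (u ∷ us) + 2 * leavesF (u ∷ us))
    ≡⟨ cong₂ _+_ (loneLefts-leavesF t ts (m+n≡0⇒m≡0 _ y)) (loneLefts-leavesF u us (m+n≡0⇒n≡0 (youngLeavesF (t ∷ ts)) y)) ⟩
  suc (length (labelsF (t ∷ ts))) + suc (length (labelsF (u ∷ us)))
    ≡⟨ +-suc (suc (length (labelsF (t ∷ ts)))) _ ⟩
  suc (suc (length (labelsF (t ∷ ts)) + length (labelsF (u ∷ us))))
    ∎
  where
  open ≡-Reasoning
  regroup : ∀ a b c d → (a + b) + 2 * (c + d) ≡ (a + 2 * c) + (b + 2 * d)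
  regroup = solve-∀

leavesF-orbit-node : ∀ j t ts us {ts′} → ts′ ∈ orbit (t ∷ ts) → leavesF (node j ts′ ∷ us) ≡ leavesF ts′ + leavesF us
leavesF-orbit-node j t ts us {[]}    ts∈ = contradiction ts∈ ([]∉orbit t ts)
leavesF-orbit-node j t ts us {_ ∷ _} ts∈ = refl

-- Each lone left contributes a factor 1 + x independently of the others: keeping its subtree on the
-- left preserves the number of leaves, turning it makes the node a leaf.
∑-orbit : ∀ ts h → youngLeavesF ts ≡ 0 → ∑ℕ (orbit ts) (h ∘ leavesF) ≡ binom (loneLefts ts) (leavesF ts) h
∑-orbit []                         h _ = +-identityʳ (h 0)
∑-orbit (node j []       ∷ [])     h _ = +-identityʳ (h 1)
∑-orbit (node j (t ∷ ts) ∷ [])     h y = begin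
  ∑ℕ (map (λ vs → graft j vs []) O ++ map (graft j []) O) (h ∘ leavesF)
    ≡⟨ ∑ℕ-++ (map (λ vs → graft j vs []) O) (map (graft j []) O) (h ∘ leavesF) ⟩
  ∑ℕ (map (λ vs → graft j vs []) O) (h ∘ leavesF) + ∑ℕ (map (graft j []) O) (h ∘ leavesF)
    ≡⟨ cong₂ _+_ (∑ℕ-map (λ vs → graft j vs []) O (h ∘ leavesF)) (∑ℕ-map (graft j []) O (h ∘ leavesF)) ⟩
  ∑ℕ O (λ vs → h (leavesF (node j vs ∷ []))) + ∑ℕ O (h ∘ suc ∘ leavesF)
    ≡⟨ cong (_+ ∑ℕ O (h ∘ suc ∘ leavesF)) (∑ℕ-cong-∈ O (λ vs∈ → cong h (trans (leavesF-orbit-node j t ts [] vs∈) (+-identityʳ _)))) ⟩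
  ∑ℕ O (h ∘ leavesF) + ∑ℕ O (h ∘ suc ∘ leavesF)
    ≡⟨ cong₂ _+_ (∑-orbit (t ∷ ts) h y) (trans (∑-orbit (t ∷ ts) (h ∘ suc) y) (sym (binom-shift (loneLefts (t ∷ ts)) (leavesF (t ∷ ts)) h))) ⟩
  binom (suc (loneLefts (t ∷ ts))) (leavesF (t ∷ ts)) h
    ≡⟨ cong (λ ℓ → binom (suc (loneLefts (t ∷ ts))) ℓ h) (+-identityʳ _) ⟨
  binom (suc (loneLefts (t ∷ ts))) (leavesF (t ∷ ts) + 0) h
    ∎
  where
  open ≡-Reasoning
  O = orbit (t ∷ ts)
∑-orbit (node j (t ∷ ts) ∷ u ∷ us) h y = begin
  ∑ℕ (cartesianProductWith (graft j) O O′) (h ∘ leavesF)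
    ≡⟨ ∑ℕ-cartesianProductWith (graft j) O O′ (h ∘ leavesF) ⟩
  ∑ℕ O (λ ts′ → ∑ℕ O′ (λ us′ → h (leavesF (node j ts′ ∷ us′))))
    ≡⟨ ∑ℕ-cong-∈ O (λ ts∈ → ∑ℕ-cong O′ (λ us′ → cong h (leavesF-orbit-node j t ts us′ ts∈))) ⟩
  ∑ℕ O (λ ts′ → ∑ℕ O′ (λ us′ → h (leavesF ts′ + leavesF us′)))
    ≡⟨ ∑ℕ-cong O (λ ts′ → ∑-orbit (u ∷ us) (λ x → h (leavesF ts′ + x)) (m+n≡0⇒n≡0 (youngLeavesF (t ∷ ts)) y)) ⟩
  ∑ℕ O (λ ts′ → binom (loneLefts (u ∷ us)) (leavesF (u ∷ us)) (λ x → h (leavesF ts′ + x)))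
    ≡⟨ ∑-orbit (t ∷ ts) (λ x′ → binom (loneLefts (u ∷ us)) (leavesF (u ∷ us)) (λ x → h (x′ + x))) (m+n≡0⇒m≡0 _ y) ⟩
  binom (loneLefts (t ∷ ts)) (leavesF (t ∷ ts)) (λ x′ → binom (loneLefts (u ∷ us)) (leavesF (u ∷ us)) (λ x → h (x′ + x)))
    ≡⟨ binom-* (loneLefts (t ∷ ts)) (loneLefts (u ∷ us)) (leavesF (t ∷ ts)) (leavesF (u ∷ us)) h ⟩
  binom (loneLefts (t ∷ ts) + loneLefts (u ∷ us)) (leavesF (t ∷ ts) + leavesF (u ∷ us)) h
    ∎
  where
  open ≡-Reasoning
  O = orbit (t ∷ ts)
  O′ = orbit (u ∷ us)

leaves>0 : ∀ t ts → 0 < leavesF (t ∷ ts)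
leaves>0 (node j [])       us = z<s
leaves>0 (node j (t ∷ ts)) us = ≤-trans (leaves>0 t ts) (m≤m+n _ _)

length-filter-≟ : ∀ (f : A → ℕ) m xs → length (filter (λ x → f x ≟ m) xs) ≡ ∑ℕ xs (λ x → δ m (f x))
length-filter-≟ f m []       = refl
length-filter-≟ f m (x ∷ xs) with f x ≟ m
... | yes refl rewrite filter-accept (λ x → f x ≟ m) {x} {xs} refl | δ-refl (f x) = cong suc (length-filter-≟ f m xs)
... | no  fx≢m rewrite filter-reject (λ x → f x ≟ m) {x} {xs} fx≢m | δ-≢ (fx≢m ∘ sym) = length-filter-≟ f m xs

∑ℕ-upTo-suc : ∀ K h → ∑ℕ (upTo (suc K)) h ≡ ∑ℕ (upTo K) h + h K
∑ℕ-upTo-suc K h = begin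
  ∑ℕ (upTo (suc K)) h         ≡⟨ cong (λ is → ∑ℕ is h) (upTo-∷ʳ K) ⟨
  ∑ℕ (upTo K ++ [ K ]) h      ≡⟨ ∑ℕ-++ (upTo K) [ K ] h ⟩
  ∑ℕ (upTo K) h + (h K + 0)   ≡⟨ cong (∑ℕ (upTo K) h +_) (+-identityʳ (h K)) ⟩
  ∑ℕ (upTo K) h + h K         ∎
  where open ≡-Reasoning

∑ℕ-upTo-≥ : ∀ K {e} (g : ℕ → ℕ) → K ≤ e → ∑ℕ (upTo K) (λ i → δ i e * g i) ≡ 0
∑ℕ-upTo-≥ zero    g K≤e = refl
∑ℕ-upTo-≥ (suc K) {e} g K<e = trans (∑ℕ-upTo-suc K (λ i → δ i e * g i))
  (cong₂ _+_ (∑ℕ-upTo-≥ K g (<⇒≤ K<e)) (cong (_* g K) (δ-≢ (<⇒≢ K<e))))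

∑ℕ-upTo-< : ∀ K {e} (g : ℕ → ℕ) → e < K → ∑ℕ (upTo K) (λ i → δ i e * g i) ≡ g e
∑ℕ-upTo-< (suc K) {e} g e<1+K with e ≟ K
... | yes refl = trans (∑ℕ-upTo-suc K (λ i → δ i e * g i))
  (trans (cong₂ _+_ (∑ℕ-upTo-≥ K g ≤-refl) (cong (_* g K) (δ-refl K))) (*-identityˡ (g K)))
... | no  e≢K  = trans (∑ℕ-upTo-suc K (λ i → δ i e * g i))
  (trans (cong₂ _+_ (∑ℕ-upTo-< K g (≤∧≢⇒< (≤-pred e<1+K) e≢K)) (cong (_* g K) (δ-≢ (e≢K ∘ sym)))) (+-identityʳ (g e)))

module _ {M : List ℕ} {u : ℕ} (E : Enumeration (Forest M u)) (M<u : All (_< u) M) {d : ℕ} (|M| : length M ≡ suc d) where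

  private
    noYoung : Enumeration (λ ts → Forest M u ts × youngLeavesF ts ≡ 0)
    noYoung = restrict (λ ts → youngLeavesF ts ≟ 0) E

    orbits : Enumeration (Forest M u)
    orbits = fibred orbit toLeft noYoung
      (λ {ts} _ → orbit-unique ts)
      (λ {ts} (forest o occ≡ , y) vs∈ → let turned = orbit-sound ts vs∈ in
        toLeft-orbit ts y vs∈ , forest (turned-ordered turned o) (λ i → trans (turned-occ turned i) (occ≡ i)))
      (λ {vs} (forest o occ≡) → let turned = orbit-sound (toLeft vs) (∈-orbit-toLeft vs) in
        (forest (turned-ordered⁻ turned o) (λ i → trans (sym (turned-occ turned i)) (occ≡ i)) , young-toLeft vs) ,
        ∈-orbit-toLeft vs)

  γ-occ : ∀ i (F : Enumeration (λ t → WeaklyIncreasingTree M t × (leaves t ≡ i + 1 × youngLeaves t ≡ 0))) →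
          cardinality F ≡ ∑ℕ (noYoung .elements) (λ ts → δ (suc i) (leavesF ts))
  γ-occ i F = begin
    length (F .elements)                                   ≡⟨ ↭-length (elements-↭ F F′ (λ p → p) (λ p → p)) ⟩
    length (map (node 0) (F″ .elements))                   ≡⟨ length-map (node 0) (F″ .elements) ⟩
    length (filter (λ ts → leavesF ts ≟ i + 1) (noYoung .elements))   ≡⟨ length-filter-≟ leavesF (i + 1) (noYoung .elements) ⟩
    ∑ℕ (noYoung .elements) (λ ts → δ (i + 1) (leavesF ts)) ≡⟨ cong (λ m → ∑ℕ (noYoung .elements) (λ ts → δ m (leavesF ts))) (+-comm i 1) ⟩
    ∑ℕ (noYoung .elements) (λ ts → δ (suc i) (leavesF ts)) ∎
    where
    open ≡-Reasoning
    F″ : Enumeration (λ ts → Forest M u ts × (leavesF ts ≡ i + 1 × youngLeavesF ts ≡ 0))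
    F″ = transfer (λ ((f , y) , l) → f , l , y) (λ (f , l , y) → (f , y) , l) (restrict (λ ts → leavesF ts ≟ i + 1) noYoung)
    F′ : Enumeration (λ t → WeaklyIncreasingTree M t × (leaves t ≡ i + 1 × youngLeaves t ≡ 0))
    F′ = rooted {Q = λ t → leaves t ≡ i + 1 × youngLeaves t ≡ 0} M<u F″

  module _ (F : ∀ i → Enumeration (λ t → WeaklyIncreasingTree M t × (leaves t ≡ i + 1 × youngLeaves t ≡ 0))) where

    γ-expansion : ∀ s → ∑ℕ (E .elements) (λ ts → δ (suc s) (leavesF ts))
                      ≡ ∑ℕ (upTo (suc ⌊ d /2⌋)) (λ i → cardinality (F i) * choose (d ∸ 2 * i) s i)
    γ-expansion s = begin
      ∑ℕ (E .elements) (δ (suc s) ∘ leavesF)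
        ≡⟨ ∑ℕ-↭ (δ (suc s) ∘ leavesF) (elements-↭ E orbits (λ p → p) (λ p → p)) ⟩
      ∑ℕ (concatMap orbit N) (δ (suc s) ∘ leavesF)
        ≡⟨ ∑ℕ-concatMap orbit N (δ (suc s) ∘ leavesF) ⟩
      ∑ℕ N (λ ts → ∑ℕ (orbit ts) (δ (suc s) ∘ leavesF))
        ≡⟨ ∑ℕ-cong-∈ N (λ {ts} ts∈ → trans (∑-orbit ts (δ (suc s)) (proj₂ (noYoung .sound ts∈))) (expand (noYoung .sound ts∈))) ⟩
      ∑ℕ N (λ ts → ∑ℕ I (λ i → δ (suc i) (leavesF ts) * choose (d ∸ 2 * i) s i))
        ≡⟨ ∑ℕ-swap N I _ ⟩
      ∑ℕ I (λ i → ∑ℕ N (λ ts → δ (suc i) (leavesF ts) * choose (d ∸ 2 * i) s i))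
        ≡⟨ ∑ℕ-cong I (λ i → trans (∑ℕ-cong N (λ ts → *-comm (δ (suc i) (leavesF ts)) _))
             (trans (∑ℕ-*ˡ N (choose (d ∸ 2 * i) s i) (λ ts → δ (suc i) (leavesF ts)))
             (trans (*-comm (choose (d ∸ 2 * i) s i) _) (cong (_* choose (d ∸ 2 * i) s i) (sym (γ-occ i (F i))))))) ⟩
      ∑ℕ I (λ i → cardinality (F i) * choose (d ∸ 2 * i) s i)
        ∎
      where
      open ≡-Reasoning
      N = noYoung .elements
      I = upTo (suc ⌊ d /2⌋)

      expand : ∀ {ts} → Forest M u ts × youngLeavesF ts ≡ 0 →
               choose (loneLefts ts) (suc s) (leavesF ts) ≡ ∑ℕ I (λ i → δ (suc i) (leavesF ts) * choose (d ∸ 2 * i) s i)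
      expand {[]}     (forest _ occ≡ , _) = contradiction (trans (↭-length (occ-≡⇒↭ [] M occ≡)) |M|) λ ()
      expand {t ∷ ts} (forest _ occ≡ , y) = go (leavesF (t ∷ ts))
        (trans (loneLefts-leavesF t ts y) (cong suc (trans (↭-length (occ-≡⇒↭ (labelsF (t ∷ ts)) M occ≡)) |M|)))
        (leaves>0 t ts)
        where
        go : ∀ ℓ → loneLefts (t ∷ ts) + 2 * ℓ ≡ suc (suc d) → 0 < ℓ →
             choose (loneLefts (t ∷ ts)) (suc s) ℓ ≡ ∑ℕ I (λ i → δ (suc i) ℓ * choose (d ∸ 2 * i) s i)
        -- With e + 1 leaves and d + 1 nodes there are d - 2e lone lefts. So the orbit is the
        -- summand `i = e`, and 2e ≤ d puts `e` within the range of summation.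
        go (suc e) eq _ = begin
          choose (loneLefts (t ∷ ts)) (suc s) (suc e)                    ≡⟨ choose-shift (loneLefts (t ∷ ts)) s e ⟩
          choose (loneLefts (t ∷ ts)) s e                                ≡⟨ cong (λ c → choose c s e) (trans (sym (m+n∸n≡m (loneLefts (t ∷ ts)) (2 * e))) (cong (_∸ 2 * e) loneLefts≡)) ⟩
          choose (d ∸ 2 * e) s e                                    ≡⟨ ∑ℕ-upTo-< (suc ⌊ d /2⌋) (λ i → choose (d ∸ 2 * i) s i) (s≤s e≤) ⟨
          ∑ℕ I (λ i → δ i e * choose (d ∸ 2 * i) s i)               ∎
          where
          loneLefts≡ : loneLefts (t ∷ ts) + 2 * e ≡ d
          loneLefts≡ = suc-injective (suc-injective (trans (regroup (loneLefts (t ∷ ts)) e) eq))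
            where
            regroup : ∀ c e → suc (suc (c + 2 * e)) ≡ c + 2 * suc e
            regroup = solve-∀
          e≤ : e ≤ ⌊ d /2⌋
          e≤ = subst (_≤ ⌊ d /2⌋) (sym (n≡⌊n+n/2⌋ e)) (⌊n/2⌋-mono (subst₂ _≤_ (cong (e +_) (+-identityʳ e)) loneLefts≡ (m≤n+m (2 * e) (loneLefts (t ∷ ts)))))

-- Inserting the single largest letter, and the two parts of the decomposition

choose-one : ∀ c e → choose c (suc e) e ≡ c
choose-one zero    e = δ-≢ (1+n≢n {e})
choose-one (suc c) e rewrite choose-one c e | choose-bottom c (suc e) = +-comm c 1

choose-pred : ∀ c → choose (suc c) c 0 ≡ suc c
choose-pred zero    = refl
choose-pred (suc c) = cong₂ _+_ (choose-top (suc c) 0) (trans (choose-shift (suc c) c 0) (choose-pred c))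

-- The supports [e, e + c] and [0, e + 1] share only e and e + 1. One new largest letter keeps the
-- number of descents when put into one of the `e` descents or at the end, and raises it by one in
-- each of the `c` rises.
choose-single : ∀ c s e → choose c s e * choose (suc e) s 0 ≡ suc e * δ s e + c * δ s (suc e)
choose-single c s e with <-cmp s e
... | tri< s<e _ _ rewrite choose-low c s<e | δ-≢ (<⇒≢ s<e) | δ-≢ (<⇒≢ (m<n⇒m<1+n s<e)) = sym (cong₂ _+_ (*-zeroʳ e) (*-zeroʳ c))
... | tri≈ _ refl _ rewrite choose-bottom c s | choose-pred s | δ-refl s | δ-≢ (<⇒≢ (n<1+n s)) =
  trans (+-identityʳ (suc s)) (sym (trans (cong₂ _+_ (*-identityʳ (suc s)) (*-zeroʳ c)) (+-identityʳ (suc s))))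
... | tri> _ _ e<s with s ≟ suc e
...   | yes refl rewrite choose-one c e | choose-top (suc e) 0 | δ-refl e | δ-≢ (>⇒≢ (n<1+n e)) = cong (_+ c * 1) (sym (*-zeroʳ e))
...   | no  s≢1+e rewrite δ-≢ (>⇒≢ e<s) | δ-≢ s≢1+e | choose-high (suc e) {s} {0} (≤∧≢⇒< e<s (s≢1+e ∘ sym)) =
  trans (*-zeroʳ (choose c s e)) (sym (cong₂ _+_ (*-zeroʳ e) (*-zeroʳ c)))

rightSlots>0 : ∀ ts → 0 < rightSlots ts
rightSlots>0 []              = z<s
rightSlots>0 (node j ts ∷ us) rewrite rightSlots-node j ts us = ≤-trans (rightSlots>0 us) (m≤n+m _ (childRight ts))

leafCount : List (List Tree) → ℕ → ℕ
leafCount Ts s = ∑slots Ts (λ x _ → δ (suc s) x)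

module _ {M u m} (E : Enumeration (Forest M u)) (|M| : length M ≡ suc m) where

  -- With m + 1 nodes there are m + 2 free slots, so reflection exchanges s + 1 leaves with m - s +
  -- 1.
  leafCount-symmetric : Mirrored (E .elements) → ∀ s → s ≤ m → leafCount (E .elements) s ≡ leafCount (E .elements) (m ∸ s)
  leafCount-symmetric mir s s≤m = trans (mir (λ x _ → δ (suc s) x))
    (∑ℕ-cong-∈ (E .elements) (λ {ts} ts∈ → flip-δ (leavesF ts) (rightSlots ts) (trans (forest-slots (E .sound ts∈)) (cong suc |M|))))
    where
    complement : suc (m ∸ s) + suc s ≡ suc (suc m)
    complement = cong suc (trans (+-suc (m ∸ s) s) (cong suc (m∸n+n≡m s≤m)))
    flip-δ : ∀ x y → x + y ≡ suc (suc m) → δ (suc s) y ≡ δ (suc (m ∸ s)) x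
    flip-δ x y eq with y ≟ suc s
    ... | yes refl rewrite +-cancelʳ-≡ (suc s) x (suc (m ∸ s)) (trans eq (sym complement)) = trans (δ-refl s) (sym (δ-refl (m ∸ s)))
    ... | no  y≢   = trans (δ-≢ (y≢ ∘ sym)) (sym (δ-≢ {suc (m ∸ s)} {x} (λ eq′ → y≢ (+-cancelˡ-≡ x y (suc s)
        (trans eq (trans (sym complement) (cong (_+ suc s) eq′)))))))

  leafCount-degree : ∀ s → m < s → leafCount (E .elements) s ≡ 0
  leafCount-degree s m<s = trans (∑ℕ-cong-∈ (E .elements) (λ {ts} ts∈ → δ-≢ (>⇒≢ (bound (rightSlots>0 ts) (trans (forest-slots (E .sound ts∈)) (cong suc |M|))))))
    (∑ℕ-0 (E .elements))
    where
    bound : ∀ {x y} → 0 < y → x + y ≡ suc (suc m) → x < suc s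
    bound {x} {suc y} _ eq = s≤s (≤-trans (m≤m+n x y) (≤-trans (≤-reflexive (suc-injective (trans (sym (+-suc x y)) eq))) m<s))

module _ (k′ N : ℕ) where

  private
    k  = suc k′
    E₁ = blockForests₁ k N
    E₂ = blockForests₂ k N

  length₁ : length (blocks k N ++ [ suc N ]) ≡ suc (N * k)
  length₁ rewrite length-++ (blocks k N) {[ suc N ]} | length-blocks k N = +-comm (N * k) 1

  length₂ : length ((blocks k N ++ [ suc N ]) ++ [ suc (suc N) ]) ≡ suc (suc (N * k))
  length₂ rewrite length-++ (blocks k N ++ [ suc N ]) {[ suc (suc N) ]} | length₁ = +-comm (suc (N * k)) 1

  descentCount : ℕ → ℕ
  descentCount s = ∑ℕ (words (replicate (suc N) k ∷ʳ 1)) (λ π → δ s (des π))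

  -- A word with e descents has y + k′ weak rises if its matching tree has y right slots. The e + 1
  -- places that keep the descents and y of the rises behave like the slots for a new node and give
  -- the first term; the other k′ rises give the second, which for positive `s` is the coefficient
  -- of x (k - 1) B.
  descentCount-leafCount : ∀ s → descentCount s ≡ leafCount (E₂ .elements) s + k′ * ∑slots (E₁ .elements) (λ x _ → δ s x)
  descentCount-leafCount s = begin
    descentCount s
      ≡⟨ words-∷ʳ (replicate (suc N) k) 1 s ⟩
    ∑ℕ (words (replicate (suc N) k)) (λ π → choose (Vec.sum (replicate (suc N) k) ∸ des π) s (des π) * choose (suc (des π)) s 0)
      ≡⟨ cong (λ m → ∑ℕ (words (replicate (suc N) k)) (λ π → choose (m ∸ des π) s (des π) * choose (suc (des π)) s 0)) (sum-replicate (suc N) k) ⟩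
    ∑ℕ (words (replicate (suc N) k)) (λ π → inserted (des π))
      ≡⟨ descents-are-leaves k′ N (inserted ∘ pred) ⟩
    ∑slots (E₁ .elements) (λ x _ → inserted (pred x))
      ≡⟨ ∑ℕ-cong-∈ (E₁ .elements) (λ {ts} ts∈ → pointwise ts (trans (forest-slots (E₁ .sound ts∈)) (cong suc length₁))) ⟩
    ∑slots (E₁ .elements) (λ x y → place 1 x y (λ x′ _ → δ (suc s) x′) + k′ * δ s x)
      ≡⟨ ∑ℕ-+ (E₁ .elements) _ _ ⟩
    ∑slots (E₁ .elements) (λ x y → place 1 x y (λ x′ _ → δ (suc s) x′)) + ∑slots (E₁ .elements) (λ x _ → k′ * δ s x)
      ≡⟨ cong₂ _+_ (sym (∑slots-fill 1 (occ-blocks₁-> k N) E₁ (λ x _ → δ (suc s) x))) (∑ℕ-*ˡ (E₁ .elements) k′ (λ ts → δ s (leavesF ts))) ⟩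
    leafCount (E₂ .elements) s + k′ * ∑slots (E₁ .elements) (λ x _ → δ s x)
      ∎
    where
    open ≡-Reasoning
    inserted : ℕ → ℕ
    inserted e = choose (suc N * k ∸ e) s e * choose (suc e) s 0

    pointwise′ : ∀ x y → 0 < x → x + y ≡ suc (suc (N * k)) →
                 inserted (pred x) ≡ place 1 x y (λ x′ _ → δ (suc s) x′) + k′ * δ s x
    pointwise′ (suc e) y _ eq = begin
      choose (suc N * k ∸ e) s e * choose (suc e) s 0             ≡⟨ cong (λ c → choose c s e * choose (suc e) s 0) (rises-count k′ (N * k) e y (suc-injective eq)) ⟩
      choose (y + k′) s e * choose (suc e) s 0                    ≡⟨ choose-single (y + k′) s e ⟩
      suc e * δ s e + (y + k′) * δ s (suc e)                  ≡⟨ regroup (suc e * δ s e) y k′ (δ s (suc e)) ⟩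
      (suc e * δ s e + y * δ s (suc e)) + k′ * δ s (suc e)    ≡⟨ cong (_+ k′ * δ s (suc e)) (place-one (suc e) y (λ x′ _ → δ (suc s) x′)) ⟨
      place 1 (suc e) y (λ x′ _ → δ (suc s) x′) + k′ * δ s (suc e) ∎
      where
      regroup : ∀ a b c x → a + (b + c) * x ≡ (a + b * x) + c * x
      regroup = solve-∀

    pointwise : ∀ ts → leavesF ts + rightSlots ts ≡ suc (suc (N * k)) →
                inserted (pred (leavesF ts)) ≡ place 1 (leavesF ts) (rightSlots ts) (λ x′ _ → δ (suc s) x′) + k′ * δ s (leavesF ts)
    pointwise []       ()
    pointwise (t ∷ ts) eq = pointwise′ (leavesF (t ∷ ts)) (rightSlots (t ∷ ts)) (leaves>0 t ts) eq

  descentCount-zero : descentCount 0 ≡ leafCount (E₂ .elements) 0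
  descentCount-zero = trans (descentCount-leafCount 0) (trans (cong (λ m → leafCount (E₂ .elements) 0 + k′ * m) no-zero)
    (trans (cong (leafCount (E₂ .elements) 0 +_) (*-zeroʳ k′)) (+-identityʳ _)))
    where
    no-leaf : ∀ ts → leavesF ts + rightSlots ts ≡ suc (suc (N * k)) → δ 0 (leavesF ts) ≡ 0
    no-leaf []       ()
    no-leaf (t ∷ ts) _ = δ-≢ (<⇒≢ (leaves>0 t ts))
    no-zero : ∑slots (E₁ .elements) (λ x _ → δ 0 x) ≡ 0
    no-zero = trans (∑ℕ-cong-∈ (E₁ .elements) (λ {ts} ts∈ → no-leaf ts (trans (forest-slots (E₁ .sound ts∈)) (cong suc length₁)))) (∑ℕ-0 (E₁ .elements))

-- Coefficients and uniqueness of the decomposition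

-- The coefficients of x^i times the power series with coefficients `u`.
delay : ℕ → (ℕ → ℕ) → ℕ → ℕ
delay zero    u s       = u s
delay (suc i) u zero    = 0
delay (suc i) u (suc s) = delay i u s

delay-choose : ∀ i c s → delay i (λ s → choose c s 0) s ≡ choose c s i
delay-choose zero    c s       = refl
delay-choose (suc i) c zero    = sym (choose-low c z<s)
delay-choose (suc i) c (suc s) = trans (delay-choose i c s) (sym (choose-shift c s i))

δ-sym : ∀ m n → δ m n ≡ δ n m
δ-sym zero    zero    = refl
δ-sym zero    (suc n) = refl
δ-sym (suc m) zero    = refl
δ-sym (suc m) (suc n) = δ-sym m n

module Coefficients {c ℓ} (R : CommutativeRing c ℓ) where

  open CommutativeRing R
    using (Carrier; _≈_; 0#; 1#; +-rawMonoid; semiring; ring; +-cong; +-congˡ; +-congʳ; *-cong; *-congʳ; zeroˡ; zeroʳ)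
    renaming (_+_ to _+ᴿ_; _*_ to _*ᴿ_; refl to ≈-refl; sym to ≈-sym; trans to ≈-trans; reflexive to ≈-reflexive;
              +-identityˡ to +ᴿ-identityˡ; +-identityʳ to +ᴿ-identityʳ; *-identityˡ to *ᴿ-identityˡ)
  open Polynomials R
  open RawMonoidDefs +-rawMonoid using () renaming (_×_ to _·_)
  open Mult semiring using (×-homo-+; ×1-homo-*)
  open RingProperties ring using (+-cancelˡ; +-cancelʳ)

  ⟦_⟧ : ℕ → Carrier
  ⟦ n ⟧ = n · 1#

  ⟦⟧-cong : ∀ {m n} → m ≡ n → ⟦ m ⟧ ≈ ⟦ n ⟧
  ⟦⟧-cong eq = ≈-reflexive (cong ⟦_⟧ eq)

  coeff-⊕ : ∀ p q s → coeff (p ⊕ q) s ≈ coeff p s +ᴿ coeff q s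
  coeff-⊕ []      q       s       = ≈-sym (+ᴿ-identityˡ _)
  coeff-⊕ (r ∷ p) []      s       = ≈-sym (+ᴿ-identityʳ _)
  coeff-⊕ (r ∷ p) (t ∷ q) zero    = ≈-refl
  coeff-⊕ (r ∷ p) (t ∷ q) (suc s) = coeff-⊕ p q s

  coeff-scale : ∀ r q s → coeff (map (r *ᴿ_) q) s ≈ r *ᴿ coeff q s
  coeff-scale r []      s       = ≈-sym (zeroʳ r)
  coeff-scale r (t ∷ q) zero    = ≈-refl
  coeff-scale r (t ∷ q) (suc s) = coeff-scale r q s

  coeff-∷⊗ : ∀ r p q s → coeff ((r ∷ p) ⊗ q) s ≈ r *ᴿ coeff q s +ᴿ coeff (0# ∷ (p ⊗ q)) s
  coeff-∷⊗ r p q s = ≈-trans (coeff-⊕ (map (r *ᴿ_) q) (0# ∷ (p ⊗ q)) s) (+-congʳ (coeff-scale r q s))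

  coeff-0∷ : ∀ p → (∀ s → coeff p s ≈ 0#) → ∀ s → coeff (0# ∷ p) s ≈ 0#
  coeff-0∷ p p≈0 zero    = ≈-refl
  coeff-0∷ p p≈0 (suc s) = p≈0 s

  coeff-0⊗ : ∀ p q → (∀ s → coeff p s ≈ 0#) → ∀ s → coeff (p ⊗ q) s ≈ 0#
  coeff-0⊗ []      q p≈0 s = ≈-refl
  coeff-0⊗ (r ∷ p) q p≈0 s = ≈-trans (coeff-∷⊗ r p q s) (≈-trans
    (+-cong (≈-trans (*-congʳ (p≈0 0)) (zeroˡ _)) (coeff-0∷ (p ⊗ q) (coeff-0⊗ p q (p≈0 ∘ suc)) s)) (+ᴿ-identityˡ 0#))

  coeff-1⊗ : ∀ q s → coeff ([ 1# ] ⊗ q) s ≈ coeff q s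
  coeff-1⊗ q s = ≈-trans (coeff-∷⊗ 1# [] q s) (≈-trans (+-cong (*ᴿ-identityˡ _) (coeff-0∷ [] (λ _ → ≈-refl) s)) (+ᴿ-identityʳ _))

  coeff-X⊗-zero : ∀ q → coeff (X ⊗ q) 0 ≈ 0#
  coeff-X⊗-zero q = ≈-trans (coeff-∷⊗ 0# [ 1# ] q 0) (≈-trans (+-congʳ (zeroˡ _)) (+ᴿ-identityˡ 0#))

  coeff-X⊗-suc : ∀ q s → coeff (X ⊗ q) (suc s) ≈ coeff q s
  coeff-X⊗-suc q s = ≈-trans (coeff-∷⊗ 0# [ 1# ] q (suc s)) (≈-trans (+-cong (zeroˡ _) (coeff-1⊗ q s)) (+ᴿ-identityˡ _))

  coeff-const : ∀ n s → coeff (const n) s ≈ ⟦ n * δ 0 s ⟧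
  coeff-const n zero    = ⟦⟧-cong (sym (*-identityʳ n))
  coeff-const n (suc s) = ⟦⟧-cong (sym (*-zeroʳ n))

  coeff-X↑ : ∀ i s → coeff (X ↑ i) s ≈ ⟦ δ i s ⟧
  coeff-X↑ zero    s       = ≈-trans (coeff-const 1 s) (⟦⟧-cong (*-identityˡ (δ 0 s)))
  coeff-X↑ (suc i) zero    = coeff-X⊗-zero (X ↑ i)
  coeff-X↑ (suc i) (suc s) = ≈-trans (coeff-X⊗-suc (X ↑ i) s) (coeff-X↑ i s)

  coeff-1+X⊗-zero : ∀ q → coeff ((const 1 ⊕ X) ⊗ q) 0 ≈ coeff q 0
  coeff-1+X⊗-zero q = ≈-trans (coeff-∷⊗ (⟦ 1 ⟧ +ᴿ 0#) [ 1# ] q 0) (≈-trans (+ᴿ-identityʳ _) (≈-trans (*-congʳ unit) (*ᴿ-identityˡ _)))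
    where
    unit : ⟦ 1 ⟧ +ᴿ 0# ≈ 1#
    unit = ≈-trans (+ᴿ-identityʳ _) (+ᴿ-identityʳ 1#)

  coeff-1+X⊗-suc : ∀ q s → coeff ((const 1 ⊕ X) ⊗ q) (suc s) ≈ coeff q (suc s) +ᴿ coeff q s
  coeff-1+X⊗-suc q s = ≈-trans (coeff-∷⊗ (⟦ 1 ⟧ +ᴿ 0#) [ 1# ] q (suc s))
    (+-cong (≈-trans (*-congʳ unit) (*ᴿ-identityˡ _)) (coeff-1⊗ q s))
    where
    unit : ⟦ 1 ⟧ +ᴿ 0# ≈ 1#
    unit = ≈-trans (+ᴿ-identityʳ _) (+ᴿ-identityʳ 1#)

  coeff-1+X↑ : ∀ e s → coeff ((const 1 ⊕ X) ↑ e) s ≈ ⟦ choose e s 0 ⟧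
  coeff-1+X↑ zero    s       = ≈-trans (coeff-const 1 s) (⟦⟧-cong (trans (*-identityˡ (δ 0 s)) (δ-sym 0 s)))
  coeff-1+X↑ (suc e) zero    = ≈-trans (coeff-1+X⊗-zero ((const 1 ⊕ X) ↑ e)) (≈-trans (coeff-1+X↑ e 0)
    (⟦⟧-cong (sym (trans (cong (choose e 0 0 +_) (choose-low e z<s)) (+-identityʳ _)))))
  coeff-1+X↑ (suc e) (suc s) = ≈-trans (coeff-1+X⊗-suc ((const 1 ⊕ X) ↑ e) s)
    (≈-trans (+-cong (coeff-1+X↑ e (suc s)) (≈-trans (coeff-1+X↑ e s) (⟦⟧-cong (sym (choose-shift e s 0)))))
      (≈-sym (×-homo-+ 1# (choose e (suc s) 0) _)))

  -- Only the coefficients of `p` are known, not its shape as a list. In particular `p` may be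
  -- empty, and then its coefficient at `i` shows that `n` vanishes in the ring.
  coeff-monomial⊗ : ∀ n i p q u → (∀ s → coeff p s ≈ ⟦ n * δ i s ⟧) → (∀ s → coeff q s ≈ ⟦ u s ⟧) →
                    ∀ s → coeff (p ⊗ q) s ≈ ⟦ n * delay i u s ⟧
  coeff-monomial⊗ n i [] q u p≈ q≈ s = ≈-sym (≈-trans (×1-homo-* n (delay i u s)) (≈-trans (*-congʳ n≈0) (zeroˡ _)))
    where
    n≈0 : ⟦ n ⟧ ≈ 0#
    n≈0 = ≈-trans (⟦⟧-cong (sym (trans (cong (n *_) (δ-refl i)) (*-identityʳ n)))) (≈-sym (p≈ i))
  coeff-monomial⊗ n zero (r ∷ p) q u p≈ q≈ s = ≈-trans (coeff-∷⊗ r p q s) (≈-trans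
    (+-cong (*-cong (≈-trans (p≈ 0) (⟦⟧-cong (*-identityʳ n))) (q≈ s))
            (coeff-0∷ (p ⊗ q) (coeff-0⊗ p q (λ s → ≈-trans (p≈ (suc s)) (⟦⟧-cong (*-zeroʳ n)))) s))
    (≈-trans (+ᴿ-identityʳ _) (≈-sym (×1-homo-* n (u s)))))
  coeff-monomial⊗ n (suc i) (r ∷ p) q u p≈ q≈ s = ≈-trans (coeff-∷⊗ r p q s) (≈-trans
    (+-congʳ (≈-trans (*-congʳ (≈-trans (p≈ 0) (⟦⟧-cong (*-zeroʳ n)))) (zeroˡ _)))
    (≈-trans (+ᴿ-identityˡ _) (tail s)))
    where
    tail : ∀ s → coeff (0# ∷ (p ⊗ q)) s ≈ ⟦ n * delay (suc i) u s ⟧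
    tail zero    = ⟦⟧-cong (sym (*-zeroʳ n))
    tail (suc s) = coeff-monomial⊗ n i p q u (p≈ ∘ suc) q≈ s

  coeff-γ-term : ∀ n i e s → coeff (const n ⊗ X ↑ i ⊗ (const 1 ⊕ X) ↑ e) s ≈ ⟦ n * choose e s i ⟧
  coeff-γ-term n i e s = ≈-trans
    (coeff-monomial⊗ n i (const n ⊗ X ↑ i) ((const 1 ⊕ X) ↑ e) (λ s → choose e s 0)
      (coeff-monomial⊗ n 0 (const n) (X ↑ i) (δ i) (coeff-const n) (coeff-X↑ i))
      (coeff-1+X↑ e) s)
    (⟦⟧-cong (cong (n *_) (delay-choose i e s)))

  coeff-∑ : ∀ {x} {A : Set x} (xs : List A) f (u : A → ℕ) s → (∀ x → coeff (f x) s ≈ ⟦ u x ⟧) → coeff (∑ xs f) s ≈ ⟦ ∑ℕ xs u ⟧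
  coeff-∑ []       f u s f≈ = ≈-refl
  coeff-∑ (x ∷ xs) f u s f≈ = ≈-trans (coeff-⊕ (f x) (∑ xs f) s)
    (≈-trans (+-cong (f≈ x) (coeff-∑ xs f u s f≈)) (≈-sym (×-homo-+ 1# (u x) (∑ℕ xs u))))

  -- The coefficients of a are determined successively: b s is read off from p at the mirror image
  -- d − s of s + 1, where a takes the value a s.

  decomposition-unique : ∀ {D p a b} (P A B : ℕ → ℕ) → IsDecomposition (suc D) p a b →
    (∀ s → coeff p s ≈ ⟦ P s ⟧) → P 0 ≡ A 0 → (∀ s → P (suc s) ≡ A (suc s) + B s) →
    (∀ s → s ≤ suc D → A s ≡ A (suc D ∸ s)) → (∀ s → s ≤ D → B s ≡ B (D ∸ s)) →
    ∀ s → s ≤ suc D → coeff a s ≈ ⟦ A s ⟧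
  decomposition-unique {D} {p} {a} {b} P A B dec p≈ P₀ P₊ A-sym B-sym = go
    where
    open IsDecomposition dec
    p-zero : coeff p 0 ≈ coeff a 0
    p-zero = ≈-trans (decomposes 0) (≈-trans (coeff-⊕ a (X ⊗ b) 0) (≈-trans (+-congˡ (coeff-X⊗-zero b)) (+ᴿ-identityʳ _)))

    p-suc : ∀ s → coeff a (suc s) +ᴿ coeff b s ≈ ⟦ A (suc s) ⟧ +ᴿ ⟦ B s ⟧
    p-suc s = ≈-trans (≈-sym (≈-trans (decomposes (suc s)) (≈-trans (coeff-⊕ a (X ⊗ b) (suc s)) (+-congˡ (coeff-X⊗-suc b s)))))
      (≈-trans (p≈ (suc s)) (≈-trans (⟦⟧-cong (P₊ s)) (×-homo-+ 1# (A (suc s)) (B s))))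

    go : ∀ s → s ≤ suc D → coeff a s ≈ ⟦ A s ⟧
    go zero    _         = ≈-trans (≈-sym p-zero) (≈-trans (p≈ 0) (⟦⟧-cong P₀))
    go (suc s) (s≤s s≤D) = +-cancelʳ (coeff b s) _ _ (≈-trans (p-suc s) (+-congˡ (≈-sym b≈)))
      where
      mirror : suc D ∸ s ≡ suc (D ∸ s)
      mirror = +-∸-assoc 1 s≤D
      a≈ : coeff a (suc (D ∸ s)) ≈ ⟦ A (suc (D ∸ s)) ⟧
      a≈ = ≈-trans (≈-reflexive (cong (coeff a) (sym mirror))) (≈-trans (≈-sym (a-symmetric s (m≤n⇒m≤1+n s≤D)))
        (≈-trans (go s (m≤n⇒m≤1+n s≤D)) (⟦⟧-cong (trans (A-sym s (m≤n⇒m≤1+n s≤D)) (cong A mirror)))))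
      b≈ : coeff b s ≈ ⟦ B s ⟧
      b≈ = ≈-trans (b-symmetric s s≤D) (≈-trans
        (+-cancelˡ (coeff a (suc (D ∸ s))) _ _ (≈-trans (p-suc (D ∸ s)) (+-congʳ (≈-sym a≈))))
        (⟦⟧-cong (sym (B-sym s s≤D))))

  -- The degree is a variable with an equation: uniqueness needs it as a successor, while the
  -- theorem has it as a product plus one.
  decomposition-γ : ∀ k′ N d → d ≡ suc (N * suc k′) → ∀ a b →
    IsDecomposition d (multisetEulerian (replicate (suc N) (suc k′) ∷ʳ 1)) a b →
    a ≋ ∑ (upTo (suc ⌊ d /2⌋)) (λ i → const (γ (suc k′) (suc (suc N)) i) ⊗ X ↑ i ⊗ (const 1 ⊕ X) ↑ (d ∸ 2 * i))
  decomposition-γ k′ N d refl a b dec s = ≈-trans a≈ (≈-sym (≈-trans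
    (coeff-∑ (upTo (suc ⌊ d /2⌋)) (λ i → const (γ k (suc (suc N)) i) ⊗ X ↑ i ⊗ (const 1 ⊕ X) ↑ (d ∸ 2 * i)) (λ i → γ k (suc (suc N)) i * choose (d ∸ 2 * i) s i) s
      (λ i → coeff-γ-term (γ k (suc (suc N)) i) i (d ∸ 2 * i) s))
    (⟦⟧-cong (sym (γ-expansion E M<u length-M (γ-trees k (suc (suc N))) s)))))
    where
    k = suc k′
    E₁ = blockForests₁ k N
    E₂ = blockForests₂ k N

    assoc : (blocks k N ++ [ suc N ]) ++ [ suc (suc N) ] ≡ treeMultiset k (suc (suc N))
    assoc = ++-assoc (blocks k N) [ suc N ] [ suc (suc N) ]

    E : Enumeration (Forest (treeMultiset k (suc (suc N))) (suc (suc (suc N))))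
    E = transfer (λ {ts} → subst (λ M → Forest M (suc (suc (suc N))) ts) assoc)
                 (λ {ts} → subst (λ M → Forest M (suc (suc (suc N))) ts) (sym assoc)) E₂

    length-M : length (treeMultiset k (suc (suc N))) ≡ suc d
    length-M = trans (cong length (sym assoc)) (length₂ k′ N)

    M<u : All (_< suc (suc (suc N))) (treeMultiset k (suc (suc N)))
    M<u = All.tabulate λ {i} i∈ → ≰⇒> λ u≤i → contradiction (absent u≤i) (>⇒≢ (∈⇒occ i∈))
      where
      absent : ∀ {i} → suc (suc (suc N)) ≤ i → occ i (treeMultiset k (suc (suc N))) ≡ 0
      absent {i} u≤i = trans (∑ℕ-++ (blocks k N) (suc N ∷ suc (suc N) ∷ []) (δ i))
        (cong₂ _+_ (occ-blocks-> k N (≤-trans (m≤n+m (suc N) 2) u≤i))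
          (cong₂ (λ x y → x + (y + 0)) (δ-≢ (>⇒≢ (≤-trans (n≤1+n _) u≤i))) (δ-≢ (>⇒≢ u≤i))))

    p≈ : ∀ s → coeff (multisetEulerian (replicate (suc N) k ∷ʳ 1)) s ≈ ⟦ descentCount k′ N s ⟧
    p≈ s = coeff-∑ (words (replicate (suc N) k ∷ʳ 1)) (λ π → X ↑ des π) (λ π → δ s (des π)) s
      (λ π → ≈-trans (coeff-X↑ (des π) s) (⟦⟧-cong (δ-sym (des π) s)))

    a≈ : coeff a s ≈ ⟦ leafCount (E₂ .elements) s ⟧
    a≈ with s ≤? d
    ... | yes s≤d = decomposition-unique (descentCount k′ N) (leafCount (E₂ .elements)) (λ s → k′ * leafCount (E₁ .elements) s) dec p≈
      (descentCount-zero k′ N) (λ s → descentCount-leafCount k′ N (suc s))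
      (leafCount-symmetric E₂ (length₂ k′ N) (mirrored-blocks₂ k′ N))
      (λ s s≤D → cong (k′ *_) (leafCount-symmetric E₁ (length₁ k′ N) (mirrored-blocks₁ k′ N) s s≤D))
      s s≤d
    ... | no  s≰d = ≈-trans (IsDecomposition.a-degree dec s (≰⇒> s≰d))
      (⟦⟧-cong (sym (leafCount-degree E₂ (length₂ k′ N) s (≰⇒> s≰d))))

theorem27 : ∀ {c ℓ} (R : CommutativeRing c ℓ) → let open Polynomials R in
    ∀ (k n : ℕ) → 2 ≤ k → 2 ≤ n →
    let d = k * (n ∸ 2) + 1 in
    ∀ (a b : Poly) →
    IsDecomposition d (multisetEulerian (replicate (n ∸ 1) k ∷ʳ 1)) a b →
    a ≋ ∑ (upTo (suc ⌊ d /2⌋)) (λ i → const (γ k n i) ⊗ X ↑ i ⊗ (const 1 ⊕ X) ↑ (d ∸ 2 * i))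
theorem27 R (suc k) (suc (suc n)) (s≤s _) (s≤s (s≤s _)) =
  Coefficients.decomposition-γ R k n (suc k * n + 1) (trans (+-comm (suc k * n) 1) (cong suc (*-comm (suc k) n)))
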